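{- Let $T$ be a (plane) rooted tree, viewed as a rooted tree poset. The function $\mathrm{dfs}(T)\mapsto e(T)$ is in $\#\mathsf{L}$.
   Context: $e(T)$ is the number of linear extensions (topological orderings) of the rooted tree poset $T$: bijections from the $n$ nodes of $T$ to $\{1,\dots,n\}$ in which every node receives a smaller label than each of its children. $\mathrm{dfs}(T)\in\{0,1\}^{2(n-1)}$ is the Depth-First-Search traversal of the plane rooted tree $T$ started at the root: each $1$ represents going down an edge away from the root and each $0$ represents returning along an edge towards the root, children being visited left to right. The alphabet is $\Sigma=\{0,1\}$. A function given only on strings of a specified form is extended by $0$ to all other strings. $\#\mathsf{L}$ is the class of functions $f:\Sigma^*\to\mathbb{N}_0$ such that $f(x)$ is the number of accepting computation paths on input $x$ of a fixed nondeterministic Turing machine with read-only input tape that uses $O(\log|x|)$ work space and halts on every computation path. Equivalently: there are a polynomial $q$ and a deterministic $O(\log|x|)$-space Turing machine $M$ with an additional read-once, left-to-right witness tape such that $f(x)=\#\{w\in\Sigma^{q(|x|)}\mid M(x,w)=\mathsf{yes}\}$. -}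

module Defs where

open import Data.Bool.Base using (Bool; T)
open import Data.Fin.Base as Fin using (Fin)
open import Data.Fin.Patterns using (0F; 1F)
open import Data.List.Base using (List; []; _∷_; _++_; length; lookup; null)
open import Data.List.Membership.Propositional using (_∈_)
open import Data.List.Relation.Unary.Unique.Propositional using (Unique)
open import Data.Nat.Base using (ℕ; zero; suc; pred; _+_; _*_; _≤_; _⊓_)
open import Data.Nat.Logarithm using (⌊log₂_⌋)
open import Data.Product.Base using (Σ-syntax; ∃-syntax; _×_; _,_)
open import Data.Vec.Base as Vec using (Vec)
open import Function.Base using (flip)
open import Function.Bundles using (_↔_; _⤖_; Inverse; module Bijection)
open import Induction.WellFounded using (Acc)
open import Level using (Level)
open import Relation.Binary.Bundles using (Setoid)
open import Relation.Binary.Construct.Closure.ReflexiveTransitive using (Star)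
open import Relation.Binary.PropositionalEquality
  using (_≡_; refl; sym; trans; setoid)
open import Relation.Nullary.Negation.Core using (¬_)

private
  variable
    a ℓ : Level
    A : Set a

HasCardinality : Setoid a ℓ → ℕ → Set _
HasCardinality S n = Inverse S (setoid (Fin n))

Finite : Set → Set
Finite A = ∃[ n ] (A ↔ Fin n)

------------------------------------------------------------------------
-- Plane rooted trees and their linear extensions

data PlaneTree : Set where
  node : List PlaneTree → PlaneTree

mutual
  size : PlaneTree → ℕ
  size (node ts) = suc (sizes ts)

  sizes : List PlaneTree → ℕ
  sizes []       = 0
  sizes (t ∷ ts) = size t + sizes ts

data Node : PlaneTree → Set where
  root : ∀ {t} → Node t
  sub  : ∀ {ts} (i : Fin (length ts)) → Node (lookup ts i) → Node (node ts)

-- u ⋖ v : v is a child of u.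
data _⋖_ : ∀ {t} → Node t → Node t → Set where
  top   : ∀ {ts} (i : Fin (length ts)) → root {node ts} ⋖ sub i root
  below : ∀ {ts} (i : Fin (length ts)) {u v : Node (lookup ts i)} →
          u ⋖ v → sub {ts} i u ⋖ sub i v

-- The labels 1, …, n are represented by the n elements of Fin n, in order.
record LinearExtension (t : PlaneTree) : Set where
  field
    labelling : Node t ⤖ Fin (size t)

  open Bijection labelling public using () renaming (to to label)

  field
    increasing : ∀ {u v} → u ⋖ v → label u Fin.< label v

open LinearExtension public using (label)

-- Two linear extensions are the same when they label every node alike.
LinearExtensions : PlaneTree → Setoid _ _
LinearExtensions t = record
  { Carrier       = LinearExtension t
  ; _≈_           = λ e e′ → ∀ v → label e v ≡ label e′ v
  ; isEquivalence = record
    { refl  = λ _ → refl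
    ; sym   = λ p v → sym (p v)
    ; trans = λ p q v → trans (p v) (q v)
    }
  }

------------------------------------------------------------------------
-- Strings and the depth-first-search encoding

String : Set
String = List (Fin 2)

mutual
  dfs : PlaneTree → String
  dfs (node ts) = dfsChildren ts

  dfsChildren : List PlaneTree → String
  dfsChildren []       = []
  dfsChildren (t ∷ ts) = 1F ∷ dfs t ++ 0F ∷ dfsChildren ts

-- f sends enc x to g x, and every string not of the form enc x to 0.
ZeroExtension : (A → String) → (A → ℕ) → (String → ℕ) → Set _
ZeroExtension enc g f =
  (∀ x → f (enc x) ≡ g x) × (∀ s → ¬ (∃[ x ] enc x ≡ s) → f s ≡ 0)

------------------------------------------------------------------------
-- Nondeterministic Turing machines with a read-only input tape

data Move : Set where
  left stay right : Move

-- The input is delimited by the end markers ⊢ and ⊣.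
data InputSymbol : Set where
  ⊢ ⊣ : InputSymbol
  bit : Fin 2 → InputSymbol

-- Cell 0 holds ⊢, cells 1, …, |x| hold x, and cell |x| + 1 holds ⊣.
readInput : String → ℕ → InputSymbol
readInput x       zero          = ⊢
readInput []      (suc i)       = ⊣
readInput (b ∷ x) (suc zero)    = bit b
readInput (b ∷ x) (suc (suc i)) = readInput x (suc i)

-- The input head cannot move past an end marker.
moveInput : String → Move → ℕ → ℕ
moveInput x left  i = pred i
moveInput x stay  i = i
moveInput x right i = suc i ⊓ suc (length x)

-- A two-way infinite tape, of which exactly the cells visited so far are
-- stored; the cells on either side are listed starting next to the head.
record Tape (Γ : Set) : Set where
  constructor tape
  field
    before : List Γ
    head   : Γ
    after  : List Γ

  cells : ℕ
  cells = length before + suc (length after)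

module _ {Γ : Set} (blank : Γ) where

  emptyTape : Tape Γ
  emptyTape = tape [] blank []

  moveTape : Move → Tape Γ → Tape Γ
  moveTape left  (tape []       h rs)       = tape [] blank (h ∷ rs)
  moveTape left  (tape (l ∷ ls) h rs)       = tape ls l (h ∷ rs)
  moveTape stay  t                          = t
  moveTape right (tape ls       h [])       = tape (h ∷ ls) blank []
  moveTape right (tape ls       h (r ∷ rs)) = tape (h ∷ ls) r rs

  writeMove : Γ × Move → Tape Γ → Tape Γ
  writeMove (s , m) (tape ls _ rs) = moveTape m (tape ls s rs)

record NTM : Set₁ where
  field
    State    : Set
    Γ        : Set
    finState : Finite State
    finΓ     : Finite Γ
    blank    : Γ
    #tapes   : ℕ

  -- The next state, the move of the input head, and for each work tape the
  -- symbol written and the move of its head.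
  Action : Set
  Action = State × Move × Vec (Γ × Move) #tapes

  field
    start     : State
    accepting : State → Bool
    -- The transition relation, given by its finite sets of possible actions.
    δ         : State → InputSymbol → Vec Γ #tapes → List Action
    δ-unique  : ∀ q s ws → Unique (δ q s ws)

  record Config : Set where
    constructor config
    field
      state    : State
      inputPos : ℕ
      work     : Vec (Tape Γ) #tapes

    space : ℕ
    space = Vec.sum (Vec.map Tape.cells work)

  open Config public using (state; inputPos; work; space)

  initial : Config
  initial = config start 0 (Vec.replicate #tapes (emptyTape blank))

  module Run (x : String) where

    enabled : Config → List Action
    enabled c = δ (state c) (readInput x (inputPos c)) (Vec.map Tape.head (work c))

    perform : Action → Config → Config
    perform (q , m , ws) c =
      config q (moveInput x m (inputPos c))
        (Vec.zipWith (writeMove blank) ws (work c))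

    _⟶_ : Config → Config → Set
    c ⟶ c′ = ∃[ α ] α ∈ enabled c × perform α c ≡ c′

    Reachable : Config → Set
    Reachable = Star _⟶_ initial

    -- No infinite computation path starts at the initial configuration.
    Halts : Set
    Halts = Acc (flip _⟶_) initial

    -- A path ends exactly when no action is possible.  As δ lists no action
    -- twice, paths from c correspond to sequences of actions.
    data AcceptingPathFrom (c : Config) : Set where
      accept : T (null (enabled c)) → T (accepting (state c)) →
               AcceptingPathFrom c
      step   : ∀ {α} → α ∈ enabled c → AcceptingPathFrom (perform α c) →
               AcceptingPathFrom c

    AcceptingPath : Set
    AcceptingPath = AcceptingPathFrom initial

  LogSpace : Set
  LogSpace = ∃[ k ] ∃[ n₀ ] ∀ x → n₀ ≤ length x →
             ∀ {c} → Run.Reachable x c → space c ≤ k * ⌊log₂ length x ⌋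

------------------------------------------------------------------------
-- The counting class #L

_∈#L : (String → ℕ) → Set₁
f ∈#L = Σ[ M ∈ NTM ] let open NTM M in
  LogSpace ×
  (∀ x → Run.Halts x) ×
  (∀ x → HasCardinality (setoid (Run.AcceptingPath x)) (f x))

module Submission where

-- The linear extensions of a tree are counted by a product of binomial
-- coefficients.  Forgetting the root, which must come first, a labelling of a
-- tree is a labelling of the forest of its children; and a labelling of a
-- forest t ∷ ts amounts to a labelling of t, one of ts, and a shuffle of their
-- two sets of labels, chosen independently because no relation holds between
-- t and ts.  So e(T) is the product, over all nodes v except the root, of the
-- binomial coefficient (a + b) choose a, where a is the size of the subtree at
-- v and b is the total size of the subtrees at the siblings to the right of v
-- (LinearExtensions-cardinality).
--
-- On the string dfs(T), the nodes v correspond to the 1s, and a and b are found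
-- by scanning to the right with a counter for the depth: a is half the length
-- of the stretch from the 1 to its matching 0, and b is half the length of the
-- rest up to where the parent closes.  Keeping track of the number of open
-- edges as well makes the product 0 on strings that encode no tree
-- (countExtensions-dfs, countExtensions-zero).
--
-- A machine with a few counters bounded by the length of the input computes a
-- and b for one 1 after the other, and each time guesses a shuffle: as long as
-- a or b is positive, it decrements a nonzero one of the two, chosen
-- nondeterministically, and this can be done in exactly (a + b) choose a ways
-- (dealing).  Guesses made one after the other multiply the number of
-- accepting paths, so that this number is the product (run-program).  Holding
-- the counters in binary on work tapes takes logarithmic space (simulate).

open import Defs
open import Data.Bool.Base using (Bool; true; false; T; if_then_else_)
open import Data.Fin.Base as Fin using (Fin; zero; suc)
open import Data.Fin.Patterns using (0F; 1F; 2F; 3F; 4F)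
import Data.Fin.Properties as Fin
open import Data.List.Base using (List; []; _∷_; [_]; _++_; length; lookup; null)
open import Data.List.Membership.Propositional using (_∈_)
open import Data.List.Properties using (++-assoc; ++-identityʳ)
open import Data.List.Relation.Unary.All as All using (All; []; _∷_)
open import Data.List.Relation.Unary.AllPairs using ([]; _∷_)
open import Data.List.Relation.Unary.Any using (here; there)
open import Data.List.Relation.Unary.Unique.Propositional using (Unique)
open import Data.Nat.Base using (ℕ; zero; suc; _+_; _*_; _^_; _≤_; _<_; z≤n; s≤s; z<s; s<s; s<s⁻¹)
open import Data.Nat.Logarithm using (⌊log₂_⌋; ⌊log₂⌋-mono-≤; ⌊log₂[2^n]⌋≡n)
import Data.Nat.Properties as ℕ
open import Data.Nat.Tactic.RingSolver using (solve-∀)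
open import Data.Product.Base using (Σ-syntax; ∃-syntax; _×_; _,_; proj₁; proj₂)
open import Data.Product.Function.NonDependent.Propositional using (_×-↔_)
open import Data.Sum.Base using (_⊎_; inj₁; inj₂)
open import Data.Sum.Function.Propositional using (_⊎-↔_)
open import Data.Sum.Properties using (inj₁-injective; inj₂-injective)
open import Data.Unit.Base using (⊤; tt)
open import Data.Vec.Base as Vec using (Vec; []; _∷_; _[_]≔_)
import Data.Vec.Properties as Vec
open import Data.Vec.Relation.Binary.Pointwise.Inductive using (Pointwise; []; _∷_)
open import Function.Base using (_∘_; flip)
open import Function.Bundles using (_↔_; Inverse; mk↔ₛ′)
open import Function.Definitions using (Injective)
open import Function.Properties.Bijection using (⤖⇒↔)
open import Function.Properties.Inverse using (↔-refl; ↔-sym; ↔-trans; ↔⇒⤖)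
open import Induction.WellFounded using (Acc; acc)
open import Relation.Binary.Construct.Closure.ReflexiveTransitive using (Star; ε; _◅_)
open import Relation.Binary.PropositionalEquality
  using (_≡_; _≢_; refl; sym; trans; cong; cong₂; subst; subst₂; module ≡-Reasoning)
open import Relation.Nullary.Decidable.Core using (yes; no)
open import Relation.Nullary.Negation.Core using (¬_; contradiction)

open Inverse using (to; from; strictlyInverseˡ; strictlyInverseʳ)

private
  variable
    a b d e i k m n p r : ℕ
    A B : Set

to-injective : (g : A ↔ B) → Injective _≡_ _≡_ (to g)
to-injective g {x} {y} eq =
  trans (sym (strictlyInverseʳ g x)) (trans (cong (from g) eq) (strictlyInverseʳ g y))

-- Shuffles

-- A shuffle of a left and b right items into a sequence of n = a + b items,
-- given from the front.  Indexing by n separately avoids transports along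
-- equations between sums.
data Shuffle : ℕ → ℕ → ℕ → Set where
  done  : Shuffle 0 0 0
  takeˡ : Shuffle a b n → Shuffle (suc a) b (suc n)
  takeʳ : Shuffle a b n → Shuffle a (suc b) (suc n)

-- The number of shuffles: the binomial coefficient (a + b) choose a.
shuffles : ℕ → ℕ → ℕ
shuffles zero    zero    = 1
shuffles zero    (suc b) = shuffles zero b
shuffles (suc a) zero    = shuffles a zero
shuffles (suc a) (suc b) = shuffles a (suc b) + shuffles (suc a) b

Shuffle-length : Shuffle a b n → a + b ≡ n
Shuffle-length done                = refl
Shuffle-length (takeˡ σ)           = cong suc (Shuffle-length σ)
Shuffle-length (takeʳ {a} {b} σ) = trans (ℕ.+-suc a b) (cong suc (Shuffle-length σ))

Shuffle↔Fin : ∀ a b → a + b ≡ n → Shuffle a b n ↔ Fin (shuffles a b)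
Shuffle↔Fin zero zero refl =
  mk↔ₛ′ (λ _ → zero) (λ _ → done) (λ { zero → refl }) (λ { done → refl })
Shuffle↔Fin zero (suc b) refl = ↔-trans
  (mk↔ₛ′ (λ { (takeʳ σ) → σ }) takeʳ (λ _ → refl) (λ { (takeʳ _) → refl }))
  (Shuffle↔Fin zero b refl)
Shuffle↔Fin (suc a) zero refl = ↔-trans
  (mk↔ₛ′ (λ { (takeˡ σ) → σ }) takeˡ (λ _ → refl) (λ { (takeˡ _) → refl }))
  (Shuffle↔Fin a zero refl)
Shuffle↔Fin (suc a) (suc b) refl = ↔-trans
  (mk↔ₛ′ (λ { (takeˡ σ) → inj₁ σ ; (takeʳ σ) → inj₂ σ })
         (λ { (inj₁ σ) → takeˡ σ ; (inj₂ σ) → takeʳ σ })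
         (λ { (inj₁ _) → refl ; (inj₂ _) → refl })
         (λ { (takeˡ _) → refl ; (takeʳ _) → refl }))
  (↔-trans (Shuffle↔Fin a (suc b) refl ⊎-↔ Shuffle↔Fin (suc a) b (sym (ℕ.+-suc a b)))
           (↔-sym Fin.+↔⊎))

-- The places that a shuffle gives to the left and to the right items.
placeˡ : Shuffle a b n → Fin a → Fin n
placeˡ (takeˡ σ) zero    = zero
placeˡ (takeˡ σ) (suc i) = suc (placeˡ σ i)
placeˡ (takeʳ σ) i       = suc (placeˡ σ i)

placeʳ : Shuffle a b n → Fin b → Fin n
placeʳ (takeˡ σ) j       = suc (placeʳ σ j)
placeʳ (takeʳ σ) zero    = zero
placeʳ (takeʳ σ) (suc j) = suc (placeʳ σ j)

-- The item at a place.
unplace : Shuffle a b n → Fin n → Fin a ⊎ Fin b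
unplace (takeˡ σ) zero    = inj₁ zero
unplace (takeˡ σ) (suc k) with unplace σ k
... | inj₁ i = inj₁ (suc i)
... | inj₂ j = inj₂ j
unplace (takeʳ σ) zero    = inj₂ zero
unplace (takeʳ σ) (suc k) with unplace σ k
... | inj₁ i = inj₁ i
... | inj₂ j = inj₂ (suc j)

unplace-placeˡ : (σ : Shuffle a b n) (i : Fin a) → unplace σ (placeˡ σ i) ≡ inj₁ i
unplace-placeˡ (takeˡ σ) zero    = refl
unplace-placeˡ (takeˡ σ) (suc i) rewrite unplace-placeˡ σ i = refl
unplace-placeˡ (takeʳ σ) i       rewrite unplace-placeˡ σ i = refl

unplace-placeʳ : (σ : Shuffle a b n) (j : Fin b) → unplace σ (placeʳ σ j) ≡ inj₂ j
unplace-placeʳ (takeˡ σ) j       rewrite unplace-placeʳ σ j = refl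
unplace-placeʳ (takeʳ σ) zero    = refl
unplace-placeʳ (takeʳ σ) (suc j) rewrite unplace-placeʳ σ j = refl

-- Every place is a left place or a right place.
data Place (σ : Shuffle a b n) : Fin n → Set where
  atˡ : ∀ i → Place σ (placeˡ σ i)
  atʳ : ∀ j → Place σ (placeʳ σ j)

place : (σ : Shuffle a b n) (k : Fin n) → Place σ k
place (takeˡ σ) zero = atˡ zero
place (takeˡ σ) (suc k) with place σ k
... | atˡ i = atˡ (suc i)
... | atʳ j = atʳ j
place (takeʳ σ) zero = atʳ zero
place (takeʳ σ) (suc k) with place σ k
... | atˡ i = atˡ i
... | atʳ j = atʳ (suc j)

placeˡ-injective : (σ : Shuffle a b n) → Injective _≡_ _≡_ (placeˡ σ)
placeˡ-injective σ {i} {j} eq =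
  inj₁-injective (trans (sym (unplace-placeˡ σ i)) (trans (cong (unplace σ) eq) (unplace-placeˡ σ j)))

placeʳ-injective : (σ : Shuffle a b n) → Injective _≡_ _≡_ (placeʳ σ)
placeʳ-injective σ {i} {j} eq =
  inj₂-injective (trans (sym (unplace-placeʳ σ i)) (trans (cong (unplace σ) eq) (unplace-placeʳ σ j)))

placeˡ≢placeʳ : (σ : Shuffle a b n) {i : Fin a} {j : Fin b} → placeˡ σ i ≢ placeʳ σ j
placeˡ≢placeʳ σ {i} {j} eq
  with () ← trans (sym (unplace-placeˡ σ i)) (trans (cong (unplace σ) eq) (unplace-placeʳ σ j))

placeˡ-mono-< : (σ : Shuffle a b n) {i j : Fin a} → i Fin.< j → placeˡ σ i Fin.< placeˡ σ j
placeˡ-mono-< (takeˡ σ) {zero}  {suc j} _   = z<s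
placeˡ-mono-< (takeˡ σ) {suc i} {suc j} i<j = s<s (placeˡ-mono-< σ (s<s⁻¹ i<j))
placeˡ-mono-< (takeʳ σ)                 i<j = s<s (placeˡ-mono-< σ i<j)

placeʳ-mono-< : (σ : Shuffle a b n) {i j : Fin b} → i Fin.< j → placeʳ σ i Fin.< placeʳ σ j
placeʳ-mono-< (takeˡ σ)                 i<j = s<s (placeʳ-mono-< σ i<j)
placeʳ-mono-< (takeʳ σ) {zero}  {suc j} _   = z<s
placeʳ-mono-< (takeʳ σ) {suc i} {suc j} i<j = s<s (placeʳ-mono-< σ (s<s⁻¹ i<j))

placeˡ-cancel-< : (σ : Shuffle a b n) {i j : Fin a} → placeˡ σ i Fin.< placeˡ σ j → i Fin.< j
placeˡ-cancel-< (takeˡ σ) {zero}  {suc j} _ = z<s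
placeˡ-cancel-< (takeˡ σ) {suc i} {suc j} p = s<s (placeˡ-cancel-< σ (s<s⁻¹ p))
placeˡ-cancel-< (takeʳ σ)                 p = placeˡ-cancel-< σ (s<s⁻¹ p)

placeʳ-cancel-< : (σ : Shuffle a b n) {i j : Fin b} → placeʳ σ i Fin.< placeʳ σ j → i Fin.< j
placeʳ-cancel-< (takeˡ σ)                 p = placeʳ-cancel-< σ (s<s⁻¹ p)
placeʳ-cancel-< (takeʳ σ) {zero}  {suc j} _ = z<s
placeʳ-cancel-< (takeʳ σ) {suc i} {suc j} p = s<s (placeʳ-cancel-< σ (s<s⁻¹ p))

-- A shuffle is determined by which places are left places.
Shuffle-unique : (σ τ : Shuffle a b n) →
                 (∀ i j → placeˡ σ i ≢ placeʳ τ j) → (∀ i j → placeˡ τ i ≢ placeʳ σ j) →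
                 σ ≡ τ
Shuffle-unique done      done      _ _ = refl
Shuffle-unique (takeˡ σ) (takeˡ τ) p q =
  cong takeˡ (Shuffle-unique σ τ (λ i j → p (suc i) j ∘ cong suc) (λ i j → q (suc i) j ∘ cong suc))
Shuffle-unique (takeˡ σ) (takeʳ τ) p q = contradiction refl (p zero zero)
Shuffle-unique (takeʳ σ) (takeˡ τ) p q = contradiction refl (q zero zero)
Shuffle-unique (takeʳ σ) (takeʳ τ) p q =
  cong takeʳ (Shuffle-unique σ τ (λ i j → p i (suc j) ∘ cong suc) (λ i j → q i (suc j) ∘ cong suc))

someShuffle : ∀ a b → Shuffle a b (a + b)
someShuffle zero    zero    = done
someShuffle zero    (suc b) = takeʳ (someShuffle zero b)
someShuffle (suc a) b       = takeˡ (someShuffle a b)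

-- Splitting a sequence

-- A sequence of elements of A ⊎ B is a shuffle of a sequence of elements of
-- A and a sequence of elements of B.
record Splitting {A B : Set} {n : ℕ} (c : Fin n → A ⊎ B) (a b : ℕ) : Set where
  constructor splitting
  field
    shuffle : Shuffle a b n
    seqˡ    : Fin a → A
    seqʳ    : Fin b → B
    atˡ-≡   : ∀ i → c (placeˡ shuffle i) ≡ inj₁ (seqˡ i)
    atʳ-≡   : ∀ j → c (placeʳ shuffle j) ≡ inj₂ (seqʳ j)

split : (c : Fin n → A ⊎ B) → ∃[ a ] ∃[ b ] Splitting c a b
split {zero}  c = 0 , 0 , splitting done (λ ()) (λ ()) (λ ()) (λ ())
split {suc n} c with split (c ∘ suc) | c zero in eq
... | a , b , splitting σ f h p q | inj₁ x = suc a , b , splitting (takeˡ σ)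
  (λ { zero → x ; (suc i) → f i }) h (λ { zero → eq ; (suc i) → p i }) q
... | a , b , splitting σ f h p q | inj₂ y = a , suc b , splitting (takeʳ σ)
  f (λ { zero → y ; (suc j) → h j }) p (λ { zero → eq ; (suc j) → q j })

-- If an injective sequence is as long as A and B together have elements, then
-- every element occurs, and the two parts have the sizes of A and B.
split-lengths : (c : Fin (a + b) → A ⊎ B) → Injective _≡_ _≡_ c → A ↔ Fin a → B ↔ Fin b →
                Splitting c a b
split-lengths {a} {b} {A} {B} c c-inj A↔ B↔ with split c
... | a′ , b′ , s@(splitting σ f h p q) = resize a′≡a b′≡b s
  where
  open ℕ.≤-Reasoning
  resize : ∀ {a′ b′} → a′ ≡ a → b′ ≡ b → Splitting c a′ b′ → Splitting c a b
  resize refl refl s = s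

  f-inj : Injective _≡_ _≡_ f
  f-inj {i} {j} eq = placeˡ-injective σ (c-inj (trans (p i) (trans (cong inj₁ eq) (sym (p j)))))

  h-inj : Injective _≡_ _≡_ h
  h-inj {i} {j} eq = placeʳ-injective σ (c-inj (trans (q i) (trans (cong inj₂ eq) (sym (q j)))))

  a′≤a : a′ ≤ a
  a′≤a = Fin.injective⇒≤ (f-inj ∘ to-injective A↔)

  b′≤b : b′ ≤ b
  b′≤b = Fin.injective⇒≤ (h-inj ∘ to-injective B↔)

  a′≡a : a′ ≡ a
  a′≡a = ℕ.≤-antisym a′≤a (ℕ.+-cancelʳ-≤ b a a′ (begin
    a + b    ≡⟨ Shuffle-length σ ⟨
    a′ + b′  ≤⟨ ℕ.+-monoʳ-≤ a′ b′≤b ⟩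
    a′ + b   ∎))

  b′≡b : b′ ≡ b
  b′≡b = ℕ.+-cancelˡ-≡ a b′ b (trans (cong (_+ b′) (sym a′≡a)) (Shuffle-length σ))

-- A numbering of A ⊎ B given as a shuffle of a numbering of A and one of B.
record Unshuffling {A B : Set} (a b : ℕ) (g : (A ⊎ B) ↔ Fin (a + b)) : Set where
  constructor unshuffling
  field
    shuffle : Shuffle a b (a + b)
    numˡ    : A ↔ Fin a
    numʳ    : B ↔ Fin b
    numˡ-≡  : ∀ x → placeˡ shuffle (to numˡ x) ≡ to g (inj₁ x)
    numʳ-≡  : ∀ y → placeʳ shuffle (to numʳ y) ≡ to g (inj₂ y)

-- Every numbering is of this form: split the sequence in which g lists the
-- elements.
unshuffle : (g : (A ⊎ B) ↔ Fin (a + b)) → A ↔ Fin a → B ↔ Fin b → Unshuffling a b g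
unshuffle {A} {B} {a} {b} g A↔ B↔
  with splitting σ f h p q ← split-lengths (from g) (to-injective (↔-sym g)) A↔ B↔ =
  unshuffling σ
    (mk↔ₛ′ (proj₁ ∘ numˡ) f (λ i → placeˡ-injective σ (trans (proj₂ (numˡ (f i))) (sym (g-f i))))
           (λ x → inj₁-injective (to-injective g (trans (sym (g-f _)) (proj₂ (numˡ x))))))
    (mk↔ₛ′ (proj₁ ∘ numʳ) h (λ j → placeʳ-injective σ (trans (proj₂ (numʳ (h j))) (sym (g-h j))))
           (λ y → inj₂-injective (to-injective g (trans (sym (g-h _)) (proj₂ (numʳ y))))))
    (proj₂ ∘ numˡ) (proj₂ ∘ numʳ)
  where
  g-f : ∀ i → placeˡ σ i ≡ to g (inj₁ (f i))
  g-f i = trans (sym (strictlyInverseˡ g _)) (cong (to g) (p i))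

  g-h : ∀ j → placeʳ σ j ≡ to g (inj₂ (h j))
  g-h j = trans (sym (strictlyInverseˡ g _)) (cong (to g) (q j))

  numˡ : ∀ x → ∃[ i ] placeˡ σ i ≡ to g (inj₁ x)
  numˡ x with to g (inj₁ x) in eq | place σ (to g (inj₁ x))
  ... | .(placeˡ σ i) | atˡ i = i , refl
  ... | .(placeʳ σ j) | atʳ j with () ← to-injective g (trans eq (g-h j))

  numʳ : ∀ y → ∃[ j ] placeʳ σ j ≡ to g (inj₂ y)
  numʳ y with to g (inj₂ y) in eq | place σ (to g (inj₂ y))
  ... | .(placeˡ σ i) | atˡ i with () ← to-injective g (trans eq (g-f i))
  ... | .(placeʳ σ j) | atʳ j = j , refl

-- Linear extensions of a tree

-- The nodes of a forest.
FNode : List PlaneTree → Set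
FNode ts = Σ[ i ∈ Fin (length ts) ] Node (lookup ts i)

-- The code of a linear extension: for each node except the root, how the labels
-- of its subtree are shuffled with those of its siblings' subtrees to the right.
mutual
  Code : PlaneTree → Set
  Code (node ts) = Codes ts

  Codes : List PlaneTree → Set
  Codes []       = ⊤
  Codes (t ∷ ts) = Shuffle (size t) (sizes ts) (size t + sizes ts) × Code t × Codes ts

-- The number of codes: a product of binomial coefficients.
mutual
  #ext : PlaneTree → ℕ
  #ext (node ts) = #exts ts

  #exts : List PlaneTree → ℕ
  #exts []       = 1
  #exts (t ∷ ts) = shuffles (size t) (sizes ts) * (#ext t * #exts ts)

mutual
  Code↔Fin : ∀ t → Code t ↔ Fin (#ext t)
  Code↔Fin (node ts) = Codes↔Fin ts

  Codes↔Fin : ∀ ts → Codes ts ↔ Fin (#exts ts)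
  Codes↔Fin [] = mk↔ₛ′ (λ _ → zero) (λ _ → tt) (λ { zero → refl }) (λ _ → refl)
  Codes↔Fin (t ∷ ts) = ↔-trans
    (Shuffle↔Fin (size t) (sizes ts) refl ×-↔ ↔-trans (Code↔Fin t ×-↔ Codes↔Fin ts) (↔-sym Fin.*↔×))
    (↔-sym Fin.*↔×)

-- Some code, giving some numbering of the nodes; it serves to show that t has
-- size t many nodes.
mutual
  someCode : ∀ t → Code t
  someCode (node ts) = someCodes ts

  someCodes : ∀ ts → Codes ts
  someCodes []       = tt
  someCodes (t ∷ ts) = someShuffle (size t) (sizes ts) , someCode t , someCodes ts

-- The labels that a code gives to the nodes.
mutual
  labelOf : ∀ t → Code t → Node t → Fin (size t)
  labelOf (node ts) c root      = zero
  labelOf (node ts) c (sub i u) = suc (labelsOf ts c i u)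

  labelsOf : ∀ ts → Codes ts → (i : Fin (length ts)) → Node (lookup ts i) → Fin (sizes ts)
  labelsOf (t ∷ ts) (σ , c , cs) zero    u = placeˡ σ (labelOf t c u)
  labelsOf (t ∷ ts) (σ , c , cs) (suc i) u = placeʳ σ (labelsOf ts cs i u)

mutual
  labelOf-injective : ∀ t c → Injective _≡_ _≡_ (labelOf t c)
  labelOf-injective (node ts) c {root}    {root}    _  = refl
  labelOf-injective (node ts) c {sub i u} {sub j v} eq
    with refl ← labelsOf-injective ts c i j (Fin.suc-injective eq) = refl

  labelsOf-injective : ∀ ts cs i j {u v} → labelsOf ts cs i u ≡ labelsOf ts cs j v →
                       _≡_ {A = FNode ts} (i , u) (j , v)
  labelsOf-injective (t ∷ ts) (σ , c , cs) zero zero eq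
    with refl ← labelOf-injective t c (placeˡ-injective σ eq) = refl
  labelsOf-injective (t ∷ ts) (σ , c , cs) zero (suc j) eq = contradiction eq (placeˡ≢placeʳ σ)
  labelsOf-injective (t ∷ ts) (σ , c , cs) (suc i) zero eq = contradiction (sym eq) (placeˡ≢placeʳ σ)
  labelsOf-injective (t ∷ ts) (σ , c , cs) (suc i) (suc j) eq
    with refl ← labelsOf-injective ts cs i j (placeʳ-injective σ eq) = refl

mutual
  labelOf-surjective : ∀ t c k → ∃[ u ] labelOf t c u ≡ k
  labelOf-surjective (node ts) c zero = root , refl
  labelOf-surjective (node ts) c (suc k)
    with i , u , eq ← labelsOf-surjective ts c k = sub i u , cong suc eq

  labelsOf-surjective : ∀ ts cs k → ∃[ i ] ∃[ u ] labelsOf ts cs i u ≡ k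
  labelsOf-surjective (t ∷ ts) (σ , c , cs) k with place σ k
  ... | atˡ l with u , eq ← labelOf-surjective t c l = zero , u , cong (placeˡ σ) eq
  ... | atʳ l with i , u , eq ← labelsOf-surjective ts cs l = suc i , u , cong (placeʳ σ) eq

mutual
  labelOf-increasing : ∀ t c {u v} → u ⋖ v → labelOf t c u Fin.< labelOf t c v
  labelOf-increasing (node ts) c (top i)     = z<s
  labelOf-increasing (node ts) c (below i p) = s<s (labelsOf-increasing ts c i p)

  labelsOf-increasing : ∀ ts cs i {u v} → u ⋖ v → labelsOf ts cs i u Fin.< labelsOf ts cs i v
  labelsOf-increasing (t ∷ ts) (σ , c , cs) zero    p = placeˡ-mono-< σ (labelOf-increasing t c p)
  labelsOf-increasing (t ∷ ts) (σ , c , cs) (suc i) p =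
    placeʳ-mono-< σ (labelsOf-increasing ts cs i p)

labelling↔ : ∀ t → Code t → Node t ↔ Fin (size t)
labelling↔ t c = mk↔ₛ′ (labelOf t c) (proj₁ ∘ surj) (proj₂ ∘ surj)
                       (λ u → labelOf-injective t c (proj₂ (surj (labelOf t c u))))
  where surj = labelOf-surjective t c

labellings↔ : ∀ ts → Codes ts → FNode ts ↔ Fin (sizes ts)
labellings↔ ts cs = mk↔ₛ′ (λ (i , u) → labelsOf ts cs i u) find find-label
                          (λ (i , u) → labelsOf-injective ts cs _ _ (find-label (labelsOf ts cs i u)))
  where
  find : Fin (sizes ts) → FNode ts
  find k = let i , u , _ = labelsOf-surjective ts cs k in i , u

  find-label : ∀ k → labelsOf ts cs (proj₁ (find k)) (proj₂ (find k)) ≡ k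
  find-label k = let _ , _ , eq = labelsOf-surjective ts cs k in eq

-- Different codes give different labels: the set of labels of the first
-- subtree determines the shuffle, since each numbering is surjective.
mutual
  code-unique : ∀ t {c d} → (∀ u → labelOf t c u ≡ labelOf t d u) → c ≡ d
  code-unique (node ts) same = codes-unique ts (λ i u → Fin.suc-injective (same (sub i u)))

  codes-unique : ∀ ts {cs ds} → (∀ i u → labelsOf ts cs i u ≡ labelsOf ts ds i u) → cs ≡ ds
  codes-unique []       same = refl
  codes-unique (t ∷ ts) {σ , c , cs} {τ , d , ds} same
    with refl ← Shuffle-unique σ τ
      (λ l r eq → let u , p = labelOf-surjective t c l in placeˡ≢placeʳ τ
        (trans (sym (same zero u)) (trans (cong (placeˡ σ) p) eq)))
      (λ l r eq → let u , p = labelOf-surjective t d l in placeˡ≢placeʳ σ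
        (trans (same zero u) (trans (cong (placeˡ τ) p) eq)))
    with refl ← code-unique t {c} {d} (λ u → placeˡ-injective σ (same zero u))
    with refl ← codes-unique ts {cs} {ds} (λ i u → placeʳ-injective σ (same (suc i) u)) = refl

-- Only the root has no parent.
parent : ∀ {t} (u : Node t) → u ≡ root ⊎ ∃[ w ] w ⋖ u
parent root      = inj₁ refl
parent (sub i u) with parent u
... | inj₁ refl    = inj₂ (root , top i)
... | inj₂ (w , p) = inj₂ (sub i w , below i p)

-- An increasing numbering of a tree starts at the root; taking the root away
-- leaves a numbering of the forest below it.
module _ {ts : List PlaneTree} (g : Node (node ts) ↔ Fin (size (node ts)))
         (increasing : ∀ {u v : Node (node ts)} → u ⋖ v → to g u Fin.< to g v) where

  root-first : to g root ≡ zero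
  root-first with from g zero in eq
  ... | u with parent u
  ...   | inj₁ refl    = trans (cong (to g) (sym eq)) (strictlyInverseˡ g zero)
  ...   | inj₂ (w , p) with () ← subst (to g w Fin.<_)
                          (trans (cong (to g) (sym eq)) (strictlyInverseˡ g zero)) (increasing p)

  -- All other nodes have positive labels, which are lowered by one.
  private
    lower : ∀ i u → ∃[ k ] suc k ≡ to g (sub i u)
    lower i u with to g (sub i u) in eq
    ... | suc k = k , refl
    ... | zero with () ← to-injective g (trans eq (sym root-first))

    raise : ∀ k → ∃[ (i , u) ] to g (sub i u) ≡ suc k
    raise k with from g (suc k) in eq
    ... | sub i u = (i , u) , trans (cong (to g) (sym eq)) (strictlyInverseˡ g (suc k))
    ... | root with () ← trans (sym root-first)
                               (trans (cong (to g) (sym eq)) (strictlyInverseˡ g (suc k)))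

  belowRoot : FNode ts ↔ Fin (sizes ts)
  belowRoot = mk↔ₛ′ (λ (i , u) → proj₁ (lower i u)) (proj₁ ∘ raise)
    (λ k → Fin.suc-injective (trans (proj₂ (lower _ _)) (proj₂ (raise k))))
    (λ (i , u) → sub-injective (to-injective g (trans (proj₂ (raise _)) (proj₂ (lower i u)))))
    where
    sub-injective : ∀ {i j u v} → sub {ts} i u ≡ sub j v → (i , u) ≡ (j , v)
    sub-injective refl = refl

  suc-belowRoot : ∀ i u → suc (to belowRoot (i , u)) ≡ to g (sub i u)
  suc-belowRoot i u = proj₂ (lower i u)

FNode-∷ : ∀ t ts → (Node t ⊎ FNode ts) ↔ FNode (t ∷ ts)
FNode-∷ t ts = mk↔ₛ′
  (λ { (inj₁ u) → zero , u ; (inj₂ (i , u)) → suc i , u })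
  (λ { (zero , u) → inj₁ u ; (suc i , u) → inj₂ (i , u) })
  (λ { (zero , u) → refl ; (suc i , u) → refl })
  (λ { (inj₁ u) → refl ; (inj₂ (i , u)) → refl })

-- Encodes t c g: the code c gives every node of t the label that g gives it.
Encodes : ∀ t → Code t → (Node t → Fin (size t)) → Set
Encodes t c g = ∀ u → labelOf t c u ≡ g u

EncodesForest : ∀ ts → Codes ts → (FNode ts → Fin (sizes ts)) → Set
EncodesForest ts cs g = ∀ i u → labelsOf ts cs i u ≡ g (i , u)

Increasing : ∀ t → (Node t → Fin (size t)) → Set
Increasing t g = ∀ {u v} → u ⋖ v → g u Fin.< g v

IncreasingForest : ∀ ts → (FNode ts → Fin (sizes ts)) → Set
IncreasingForest ts g = ∀ i {u v} → u ⋖ v → g (i , u) Fin.< g (i , v)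

module _ (t : PlaneTree) (ts : List PlaneTree)
         {g : (Node t ⊎ FNode ts) ↔ Fin (size t + sizes ts)}
         (s : Unshuffling (size t) (sizes ts) g) where
  open Unshuffling s

  -- Placing preserves and reflects the order, so both parts are increasing.
  increasingˡ : (∀ {u v} → u ⋖ v → to g (inj₁ u) Fin.< to g (inj₁ v)) → Increasing t (to numˡ)
  increasingˡ inc {u} {v} p =
    placeˡ-cancel-< shuffle (subst₂ Fin._<_ (sym (numˡ-≡ u)) (sym (numˡ-≡ v)) (inc p))

  increasingʳ : (∀ i {u v} → u ⋖ v → to g (inj₂ (i , u)) Fin.< to g (inj₂ (i , v))) →
                IncreasingForest ts (to numʳ)
  increasingʳ inc i {u} {v} p =
    placeʳ-cancel-< shuffle (subst₂ Fin._<_ (sym (numʳ-≡ (i , u))) (sym (numʳ-≡ (i , v))) (inc i p))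

  encodes-∷ : ∃[ c ] Encodes t c (to numˡ) → ∃[ cs ] EncodesForest ts cs (to numʳ) →
              ∃[ cs ] EncodesForest (t ∷ ts) cs (to g ∘ from (FNode-∷ t ts))
  encodes-∷ (c , eq) (cs , eqs) = (shuffle , c , cs) , λ
    { zero    u → trans (cong (placeˡ shuffle) (eq u)) (numˡ-≡ u)
    ; (suc i) u → trans (cong (placeʳ shuffle) (eqs i u)) (numʳ-≡ (i , u)) }

-- Every increasing numbering is given by a code, by induction on the tree.
mutual
  encode : ∀ t (g : Node t ↔ Fin (size t)) → Increasing t (to g) → ∃[ c ] Encodes t c (to g)
  encode (node ts) g increasing = encode-node (encodes ts (belowRoot g increasing)
      (λ i {u} {v} p → s<s⁻¹ (subst₂ Fin._<_ (sym (suc-belowRoot g increasing i u))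
                                     (sym (suc-belowRoot g increasing i v)) (increasing (below i p)))))
    where
    encode-node : ∃[ cs ] EncodesForest ts cs (to (belowRoot g increasing)) →
                  ∃[ c ] Encodes (node ts) c (to g)
    encode-node (cs , eq) =
      cs , λ { root      → sym (root-first g increasing)
             ; (sub i u) → trans (cong suc (eq i u)) (suc-belowRoot g increasing i u) }

  encodes : ∀ ts (g : FNode ts ↔ Fin (sizes ts)) → IncreasingForest ts (to g) →
            ∃[ cs ] EncodesForest ts cs (to g)
  encodes [] g increasing = tt , λ ()
  encodes (t ∷ ts) g increasing = encodes-FNode (encodes-∷ t ts s
      (encode t (Unshuffling.numˡ s) (increasingˡ t ts s (increasing zero)))
      (encodes ts (Unshuffling.numʳ s) (increasingʳ t ts s (λ i → increasing (suc i)))))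
    where
    s : Unshuffling (size t) (sizes ts) (↔-trans (FNode-∷ t ts) g)
    s = unshuffle (↔-trans (FNode-∷ t ts) g)
          (labelling↔ t (someCode t)) (labellings↔ ts (someCodes ts))

    -- The two maps of FNode-∷ cancel only on explicit nodes.
    encodes-FNode :
      ∃[ cs ] EncodesForest (t ∷ ts) cs (to g ∘ to (FNode-∷ t ts) ∘ from (FNode-∷ t ts)) →
      ∃[ cs ] EncodesForest (t ∷ ts) cs (to g)
    encodes-FNode (cs , eq) = cs , λ { zero u → eq zero u ; (suc i) u → eq (suc i) u }

LinearExtensions-cardinality : ∀ t → HasCardinality (LinearExtensions t) (#ext t)
LinearExtensions-cardinality t = record
  { to        = to (Code↔Fin t) ∘ codeOf
  ; from      = extension ∘ from (Code↔Fin t)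
  ; to-cong   = λ {e} {e′} same → cong (to (Code↔Fin t))
                  (code-unique t (λ u → trans (codeOf-label e u)
                                              (trans (same u) (sym (codeOf-label e′ u)))))
  ; from-cong = λ { refl u → refl }
  ; inverse   = (λ {k} {e} e≈ → trans
                    (cong (to (Code↔Fin t)) (code-unique t (λ u → trans (codeOf-label e u) (e≈ u))))
                    (strictlyInverseˡ (Code↔Fin t) k))
              , λ { {e} refl u → trans
                    (cong (λ c → labelOf t c u) (strictlyInverseʳ (Code↔Fin t) (codeOf e)))
                    (codeOf-label e u) }
  }
  where
  extension : Code t → LinearExtension t
  extension c = record { labelling  = ↔⇒⤖ (labelling↔ t c) ; increasing = labelOf-increasing t c }

  encoding : (e : LinearExtension t) → ∃[ c ] (∀ u → labelOf t c u ≡ label e u)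
  encoding e = encode t (⤖⇒↔ (LinearExtension.labelling e)) (LinearExtension.increasing e)

  codeOf : LinearExtension t → Code t
  codeOf e = proj₁ (encoding e)

  codeOf-label : ∀ e u → labelOf t (codeOf e) u ≡ label e u
  codeOf-label e = proj₂ (encoding e)

-- Counting linear extensions along a string

-- Given what follows a 1, scanˡ s 1 0 scans the subtree of the node that this 1
-- enters, up to the matching 0; then scanʳ scans the subtrees to its right, up
-- to a 0 that closes the parent or to the end.  The value is the number of
-- shuffles of a and b items, where a and b count the 1s of the two parts; it is
-- 0 if the string ends too early.  The edges opened in the current part and not
-- closed yet number d, but in scanˡ the edge of the first 1 is not counted.
scanʳ : String → (a b d : ℕ) → ℕ
scanʳ []       a b zero    = shuffles a b
scanʳ []       a b (suc d) = 0
scanʳ (1F ∷ s) a b d       = scanʳ s a (suc b) (suc d)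
scanʳ (0F ∷ s) a b zero    = shuffles a b
scanʳ (0F ∷ s) a b (suc d) = scanʳ s a b d

scanˡ : String → (a d : ℕ) → ℕ
scanˡ []       a d       = 0
scanˡ (1F ∷ s) a d       = scanˡ s (suc a) (suc d)
scanˡ (0F ∷ s) a zero    = scanʳ s a 0 0
scanˡ (0F ∷ s) a (suc d) = scanˡ s a d

-- The product of these numbers over all 1s of the string, provided that the
-- string closes all edges it opens as well as e edges opened before it, and no
-- others; otherwise 0.
total : String → (e : ℕ) → ℕ
total []       zero    = 1
total []       (suc e) = 0
total (1F ∷ s) e       = scanˡ s 1 0 * total s (suc e)
total (0F ∷ s) zero    = 0
total (0F ∷ s) (suc e) = total s e

countExtensions : String → ℕ
countExtensions s = total s 0

dfsChildren-∷ : ∀ us ts r →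
  dfsChildren (node us ∷ ts) ++ r ≡ 1F ∷ dfsChildren us ++ 0F ∷ dfsChildren ts ++ r
dfsChildren-∷ us ts r = cong (1F ∷_) (++-assoc (dfsChildren us) (0F ∷ dfsChildren ts) r)

private
  +-regroup : ∀ l m n → l + (m + suc n) ≡ suc (m + l + n)
  +-regroup = solve-∀

-- Scanning the encoding of a forest adds the number of its nodes to the count
-- and leaves the depth as it was.
scanˡ-dfs : ∀ ts r a d → scanˡ (dfsChildren ts ++ r) a d ≡ scanˡ r (sizes ts + a) d
scanˡ-dfs []             r a d = refl
scanˡ-dfs (node us ∷ ts) r a d = begin
  scanˡ (dfsChildren (node us ∷ ts) ++ r) a d
    ≡⟨ cong (λ s → scanˡ s a d) (dfsChildren-∷ us ts r) ⟩
  scanˡ (dfsChildren us ++ 0F ∷ dfsChildren ts ++ r) (suc a) (suc d)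
    ≡⟨ scanˡ-dfs us _ (suc a) (suc d) ⟩
  scanˡ (dfsChildren ts ++ r) (sizes us + suc a) d
    ≡⟨ scanˡ-dfs ts r _ d ⟩
  scanˡ r (sizes ts + (sizes us + suc a)) d
    ≡⟨ cong (λ k → scanˡ r k d) (+-regroup (sizes ts) (sizes us) a) ⟩
  scanˡ r (suc (sizes us) + sizes ts + a) d ∎
  where open ≡-Reasoning

scanʳ-dfs : ∀ ts r a b d → scanʳ (dfsChildren ts ++ r) a b d ≡ scanʳ r a (sizes ts + b) d
scanʳ-dfs []             r a b d = refl
scanʳ-dfs (node us ∷ ts) r a b d = begin
  scanʳ (dfsChildren (node us ∷ ts) ++ r) a b d
    ≡⟨ cong (λ s → scanʳ s a b d) (dfsChildren-∷ us ts r) ⟩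
  scanʳ (dfsChildren us ++ 0F ∷ dfsChildren ts ++ r) a (suc b) (suc d)
    ≡⟨ scanʳ-dfs us _ a (suc b) (suc d) ⟩
  scanʳ (dfsChildren ts ++ r) a (sizes us + suc b) d
    ≡⟨ scanʳ-dfs ts r a _ d ⟩
  scanʳ r a (sizes ts + (sizes us + suc b)) d
    ≡⟨ cong (λ k → scanʳ r a k d) (+-regroup (sizes ts) (sizes us) b) ⟩
  scanʳ r a (suc (sizes us) + sizes ts + b) d ∎
  where open ≡-Reasoning

-- What may follow the encoding of a forest: a 0 that closes the parent, or the
-- end of the string.
data Closing : String → Set where
  end   : Closing []
  close : ∀ {s} → Closing (0F ∷ s)

scanʳ-closing : ∀ {r} → Closing r → ∀ a b → scanʳ r a b 0 ≡ shuffles a b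
scanʳ-closing end   a b = refl
scanʳ-closing close a b = refl

total-dfs : ∀ ts {r} → Closing r → ∀ e → total (dfsChildren ts ++ r) e ≡ #exts ts * total r e
total-dfs [] {r} _ e = sym (ℕ.+-identityʳ (total r e))
total-dfs (node us ∷ ts) {r} cl e = begin
  total (dfsChildren (node us ∷ ts) ++ r) e
    ≡⟨ cong (λ s → total s e) (dfsChildren-∷ us ts r) ⟩
  scanˡ (dfsChildren us ++ rest) 1 0 * total (dfsChildren us ++ rest) (suc e)
    ≡⟨ cong₂ _*_ scan (trans (total-dfs us close (suc e)) (cong (#exts us *_) (total-dfs ts cl e))) ⟩
  shuffles (suc (sizes us)) (sizes ts) * (#exts us * (#exts ts * total r e))
    ≡⟨ regroup (shuffles (suc (sizes us)) (sizes ts)) (#exts us) (#exts ts) (total r e) ⟩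
  shuffles (suc (sizes us)) (sizes ts) * (#exts us * #exts ts) * total r e ∎
  where
  open ≡-Reasoning
  rest : String
  rest = 0F ∷ dfsChildren ts ++ r

  scan : scanˡ (dfsChildren us ++ rest) 1 0 ≡ shuffles (suc (sizes us)) (sizes ts)
  scan = begin
    scanˡ (dfsChildren us ++ rest) 1 0
      ≡⟨ scanˡ-dfs us rest 1 0 ⟩
    scanʳ (dfsChildren ts ++ r) (sizes us + 1) 0 0
      ≡⟨ scanʳ-dfs ts r _ 0 0 ⟩
    scanʳ r (sizes us + 1) (sizes ts + 0) 0
      ≡⟨ scanʳ-closing cl _ _ ⟩
    shuffles (sizes us + 1) (sizes ts + 0)
      ≡⟨ cong₂ shuffles (ℕ.+-comm (sizes us) 1) (ℕ.+-identityʳ (sizes ts)) ⟩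
    shuffles (suc (sizes us)) (sizes ts) ∎

  regroup : ∀ k l m n → k * (l * (m * n)) ≡ k * (l * m) * n
  regroup = solve-∀

-- Balanced e s: in s there are e unmatched 0s, and before, between and after
-- them stand encodings of forests.
data Balanced : ℕ → String → Set where
  end   : ∀ ts → Balanced 0 (dfsChildren ts)
  close : ∀ ts {e s} → Balanced e s → Balanced (suc e) (dfsChildren ts ++ 0F ∷ s)

balanced-1 : ∀ {e s} → Balanced (suc e) s → Balanced e (1F ∷ s)
balanced-1 (close us (end ts)) = end (node us ∷ ts)
balanced-1 (close us (close ts {s = s} bal))
  rewrite sym (dfsChildren-∷ us ts (0F ∷ s)) = close (node us ∷ ts) bal

balanced : ∀ s e → total s e ≢ 0 → Balanced e s
balanced []       zero    _  = end []
balanced []       (suc e) ≢0 = contradiction refl ≢0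
balanced (0F ∷ s) zero    ≢0 = contradiction refl ≢0
balanced (0F ∷ s) (suc e) ≢0 = close [] (balanced s e ≢0)
balanced (1F ∷ s) e       ≢0 = balanced-1 (balanced s (suc e) λ ≡0 →
  ≢0 (trans (cong (scanˡ s 1 0 *_) ≡0) (ℕ.*-zeroʳ (scanˡ s 1 0))))

countExtensions-dfs : ∀ t → countExtensions (dfs t) ≡ #ext t
countExtensions-dfs (node ts) = begin
  total (dfsChildren ts) 0        ≡⟨ cong (λ s → total s 0) (++-identityʳ (dfsChildren ts)) ⟨
  total (dfsChildren ts ++ []) 0  ≡⟨ total-dfs ts end 0 ⟩
  #exts ts * 1                    ≡⟨ ℕ.*-identityʳ (#exts ts) ⟩
  #exts ts                        ∎
  where open ≡-Reasoning

countExtensions-zero : ∀ s → ¬ (∃[ t ] dfs t ≡ s) → countExtensions s ≡ 0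
countExtensions-zero s s∉dfs with countExtensions s ℕ.≟ 0
... | yes ≡0 = ≡0
... | no  ≢0 with balanced s 0 ≢0
...   | end ts = contradiction (node ts , refl) s∉dfs

-- Computation trees

module Computation (M : NTM) (x : String) where
  open NTM M
  open Run x

  -- ComputationTree cells c n: every computation from c has at most two choices
  -- at each step, halts, and uses at most the given number of cells; and n
  -- computation paths from c accept.
  data ComputationTree (cells : ℕ) (c : Config) : ℕ → Set where
    leaf   : enabled c ≡ [] → space c ≤ cells →
             ComputationTree cells c (if accepting (state c) then 1 else 0)
    unary  : ∀ {α n} → enabled c ≡ [ α ] → space c ≤ cells →
             ComputationTree cells (perform α c) n → ComputationTree cells c n
    binary : ∀ {α β n₁ n₂} → enabled c ≡ α ∷ β ∷ [] → space c ≤ cells →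
             ComputationTree cells (perform α c) n₁ → ComputationTree cells (perform β c) n₂ →
             ComputationTree cells c (n₁ + n₂)

  private
    variable
      cells : ℕ
      c c′ : Config

  tree-space : ComputationTree cells c n → space c ≤ cells
  tree-space (leaf _ le)       = le
  tree-space (unary _ le _)    = le
  tree-space (binary _ le _ _) = le

  tree-child : ComputationTree cells c n → c ⟶ c′ → ∃[ n′ ] ComputationTree cells c′ n′
  tree-child {c = c} (leaf eq _) (α , α∈ , refl) with () ← subst (α ∈_) eq α∈
  tree-child (unary eq _ t) (α , α∈ , refl) with subst (α ∈_) eq α∈
  ... | here refl = _ , t
  tree-child (binary eq _ t u) (α , α∈ , refl) with subst (α ∈_) eq α∈
  ... | here refl         = _ , t
  ... | there (here refl) = _ , u

  reachable-space : ComputationTree cells c n → Star _⟶_ c c′ → space c′ ≤ cells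
  reachable-space t ε = tree-space t
  reachable-space t (c⟶ ◅ r) = reachable-space (proj₂ (tree-child t c⟶)) r

  halts-at : ∀ {as} → enabled c ≡ as → All (λ α → Acc (flip _⟶_) (perform α c)) as →
             Acc (flip _⟶_) c
  halts-at eq children = acc λ { (α , α∈ , refl) → All.lookup children (subst (α ∈_) eq α∈) }

  tree-halts : ComputationTree cells c n → Acc (flip _⟶_) c
  tree-halts (leaf eq _)       = halts-at eq []
  tree-halts (unary eq _ t)    = halts-at eq (tree-halts t ∷ [])
  tree-halts (binary eq _ t u) = halts-at eq (tree-halts t ∷ tree-halts u ∷ [])

  -- The accepting paths from c, if as is the list of actions enabled at c.
  -- Keeping the list abstract lets it be replaced by an explicit one.
  PathsVia : Config → List Action → Set
  PathsVia c as = (T (null as) × T (accepting (state c))) ⊎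
                  (Σ[ α ∈ Action ] α ∈ as × AcceptingPathFrom (perform α c))

  paths-unfold : ∀ {as} → enabled c ≡ as → AcceptingPathFrom c ↔ PathsVia c as
  paths-unfold refl = mk↔ₛ′
    (λ { (accept p q) → inj₁ (p , q) ; (step α∈ path) → inj₂ (_ , α∈ , path) })
    (λ { (inj₁ (p , q)) → accept p q ; (inj₂ (_ , α∈ , path)) → step α∈ path })
    (λ { (inj₁ _) → refl ; (inj₂ _) → refl })
    (λ { (accept _ _) → refl ; (step _ _) → refl })

  tree-paths : ComputationTree cells c n → AcceptingPathFrom c ↔ Fin n
  tree-paths {c = c} (leaf eq _) = ↔-trans (paths-unfold eq) (verdict (accepting (state c)))
    where
    verdict : ∀ b → ((⊤ × T b) ⊎ (Σ[ α ∈ Action ] α ∈ [] × AcceptingPathFrom (perform α c))) ↔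
                    Fin (if b then 1 else 0)
    verdict true  = mk↔ₛ′ (λ _ → zero) (λ _ → inj₁ _)
                          (λ { zero → refl }) (λ { (inj₁ _) → refl ; (inj₂ (_ , () , _)) })
    verdict false = mk↔ₛ′ (λ { (inj₁ (_ , ())) ; (inj₂ (_ , () , _)) }) (λ ())
                          (λ ()) (λ { (inj₁ (_ , ())) ; (inj₂ (_ , () , _)) })
  tree-paths {c = c} (unary {α} eq _ t) = ↔-trans (paths-unfold eq) (↔-trans only (tree-paths t))
    where
    only : PathsVia c [ α ] ↔ AcceptingPathFrom (perform α c)
    only = mk↔ₛ′ (λ { (inj₂ (_ , here refl , path)) → path }) (λ path → inj₂ (_ , here refl , path))
                 (λ _ → refl) (λ { (inj₂ (_ , here refl , _)) → refl })
  tree-paths {c = c} (binary {α} {β} eq _ t u) =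
    ↔-trans (paths-unfold eq) (↔-trans either
      (↔-trans (tree-paths t ⊎-↔ tree-paths u) (↔-sym Fin.+↔⊎)))
    where
    either : PathsVia c (α ∷ β ∷ []) ↔
             (AcceptingPathFrom (perform α c) ⊎ AcceptingPathFrom (perform β c))
    either = mk↔ₛ′
      (λ { (inj₂ (_ , here refl , path))         → inj₁ path
         ; (inj₂ (_ , there (here refl) , path)) → inj₂ path })
      (λ { (inj₁ path) → inj₂ (_ , here refl , path)
         ; (inj₂ path) → inj₂ (_ , there (here refl) , path) })
      (λ { (inj₁ _) → refl ; (inj₂ _) → refl })
      (λ { (inj₂ (_ , here refl , _)) → refl ; (inj₂ (_ , there (here refl) , _)) → refl })

-- Membership in #L from a computation tree for every input.
tree-#L : (M : NTM) (f : String → ℕ) (k n₀ : ℕ) (cells : String → ℕ) →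
          (∀ x → Computation.ComputationTree M x (cells x) (NTM.initial M) (f x)) →
          (∀ x → n₀ ≤ length x → cells x ≤ k * ⌊log₂ length x ⌋) →
          f ∈#L
tree-#L M f k n₀ cells tree bound =
  M ,
  (k , n₀ , λ x n₀≤ r → ℕ.≤-trans (Computation.reachable-space M x (tree x) r) (bound x n₀≤)) ,
  (λ x → Computation.tree-halts M x (tree x)) ,
  (λ x → Computation.tree-paths M x (tree x))

-- Binary counters

-- Work tape symbols; Fin 3 makes their finiteness immediate.
Symbol : Set
Symbol = Fin 3

pattern □ = 0F
pattern 𝟘 = 1F
pattern 𝟙 = 2F

-- Digits w l v: the cells l hold v in binary, least significant digit first,
-- with at most w digits, of which the most significant may be 0.  One blank cell
-- may follow, left by a head that ran past the digits.
data Digits : (w : ℕ) → List Symbol → ℕ → Set where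
  []    : ∀ {w} → Digits w [] 0
  blank : ∀ {w} → Digits w (□ ∷ []) 0
  zero∷ : ∀ {w l u v} → Digits w l u → v ≡ 2 * u → Digits (suc w) (𝟘 ∷ l) v
  one∷  : ∀ {w l u v} → Digits w l u → v ≡ suc (2 * u) → Digits (suc w) (𝟙 ∷ l) v

Digits-length : ∀ {w l v} → Digits w l v → length l ≤ suc w
Digits-length []          = z≤n
Digits-length blank       = s≤s z≤n
Digits-length (zero∷ d _) = s≤s (Digits-length d)
Digits-length (one∷ d _)  = s≤s (Digits-length d)

-- The effect of a sweep of a tape head along a list of cells: pass over
-- copies of c, replace the first other symbol h (a blank beyond the end) by
-- some g with Turn h g, and come back replacing each c by d.
data Sweep (Turn : Symbol → Symbol → Set) (c d : Symbol) : List Symbol → List Symbol → Set where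
  turn-end : ∀ {g} → Turn □ g → Sweep Turn c d [] (g ∷ [])
  turn     : ∀ {h g l} → Turn h g → Sweep Turn c d (h ∷ l) (g ∷ l)
  pass     : ∀ {l l′} → Sweep Turn c d l l′ → Sweep Turn c d (c ∷ l) (d ∷ l′)

-- The turns of the three sweeps that count: incrementing, finding the
-- counter zero, and decrementing.
data IncTurn : Symbol → Symbol → Set where
  □↦𝟙 : IncTurn □ 𝟙
  𝟘↦𝟙 : IncTurn 𝟘 𝟙

data ZeroTurn : Symbol → Symbol → Set where
  □↦□ : ZeroTurn □ □

data DecTurn : Symbol → Symbol → Set where
  𝟙↦𝟘 : DecTurn 𝟙 𝟘

-- The bound on the counter leaves room for a carry.
Digits-suc : ∀ {w l v} → Digits w l v → suc v < 2 ^ w →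
             ∃[ l′ ] Sweep IncTurn 𝟙 𝟘 l l′ × Digits w l′ (suc v)
Digits-suc {zero}  []    1<1 = contradiction 1<1 (ℕ.<-irrefl refl)
Digits-suc {suc w} []    _   = _ , turn-end □↦𝟙 , one∷ [] refl
Digits-suc {zero}  blank 1<1 = contradiction 1<1 (ℕ.<-irrefl refl)
Digits-suc {suc w} blank _   = _ , turn □↦𝟙 , one∷ [] refl
Digits-suc (zero∷ d refl) _  = _ , turn 𝟘↦𝟙 , one∷ d refl
Digits-suc {suc w} (one∷ {u = u} d refl) lt
  with l′ , s , d′ ← Digits-suc d (ℕ.*-cancelˡ-< 2 (suc u) (2 ^ w)
                       (subst (_< 2 ^ suc w) (sym (ℕ.*-suc 2 u)) lt))
  = _ , pass s , zero∷ d′ (sym (ℕ.*-suc 2 u))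

Digits-zero : ∀ {w l} → Digits w l 0 → ∃[ l′ ] Sweep ZeroTurn 𝟘 𝟘 l l′ × Digits w l′ 0
Digits-zero []    = _ , turn-end □↦□ , blank
Digits-zero blank = _ , turn □↦□ , blank
Digits-zero (zero∷ {u = zero} d refl)
  with l′ , s , d′ ← Digits-zero d = _ , pass s , zero∷ d′ refl

Digits-pred : ∀ {w l v} → Digits w l (suc v) → ∃[ l′ ] Sweep DecTurn 𝟘 𝟙 l l′ × Digits w l′ v
Digits-pred (one∷ d refl) = _ , turn 𝟙↦𝟘 , zero∷ d refl
Digits-pred (zero∷ {u = suc u} d eq)
  with l′ , s , d′ ← Digits-pred d
  = _ , pass s , one∷ d′ (ℕ.suc-injective (trans eq (ℕ.*-suc 2 u)))

-- Counter programs

-- Deterministic programs with a two-way input head and counters, extended by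
-- nondeterministic guesses.

data CountOp : Set where
  increment decrement : CountOp

-- The instructions of a program with k labels and m counters:
--   read f                   move the input head and jump, as f tells from the
--                            symbol under the head;
--   count increment c ℓ₀ ℓ₊  add 1 to counter c and jump to ℓ₊;
--   count decrement c ℓ₀ ℓ₊  jump to ℓ₀ if counter c is 0, and otherwise
--                            subtract 1 from it and jump to ℓ₊;
--   guess ℓ ℓ′               jump to ℓ or to ℓ′, which differ, so that no action
--                            is listed twice;
--   halt b                   accept if b is true, and reject otherwise.
data Instruction (k m : ℕ) : Set where
  read  : (InputSymbol → Move × Fin k) → Instruction k m
  count : CountOp → Fin m → (ℓ₀ ℓ₊ : Fin k) → Instruction k m
  guess : (ℓ ℓ′ : Fin k) → ℓ ≢ ℓ′ → Instruction k m
  halt  : Bool → Instruction k m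

Program : ℕ → ℕ → Set
Program k m = Fin k → Instruction k m

module _ {k m : ℕ} (P : Program k m) (x : String) (bound : ℕ) where

  -- Run ℓ i v n: started at label ℓ with the input head on cell i and the
  -- counters holding v, the program halts on every path, never increments a
  -- counter beyond the bound, and accepts on n paths.
  data Run (ℓ : Fin k) (i : ℕ) (v : Vec ℕ m) : ℕ → Set where
    halt  : ∀ {b} → P ℓ ≡ halt b → Run ℓ i v (if b then 1 else 0)
    read  : ∀ {f s μ ℓ′ n} → P ℓ ≡ read f → readInput x i ≡ s → f s ≡ (μ , ℓ′) →
            Run ℓ′ (moveInput x μ i) v n → Run ℓ i v n
    inc   : ∀ {c ℓ₀ ℓ₊ n} → P ℓ ≡ count increment c ℓ₀ ℓ₊ → Vec.lookup v c < bound →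
            Run ℓ₊ i (v [ c ]≔ suc (Vec.lookup v c)) n → Run ℓ i v n
    dec₀  : ∀ {c ℓ₀ ℓ₊ n} → P ℓ ≡ count decrement c ℓ₀ ℓ₊ → Vec.lookup v c ≡ 0 →
            Run ℓ₀ i v n → Run ℓ i v n
    dec₊  : ∀ {c ℓ₀ ℓ₊ u n} → P ℓ ≡ count decrement c ℓ₀ ℓ₊ → Vec.lookup v c ≡ suc u →
            Run ℓ₊ i (v [ c ]≔ u) n → Run ℓ i v n
    guess : ∀ {ℓ₁ ℓ₂ ≢ n₁ n₂} → P ℓ ≡ guess ℓ₁ ℓ₂ ≢ →
            Run ℓ₁ i v n₁ → Run ℓ₂ i v n₂ → Run ℓ i v (n₁ + n₂)

-- The Turing machine of a counter program

-- Each counter has a work tape.  Between instructions its head is on cell 0, the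
-- cell on which it starts.  That cell stays blank, so that a returning head knows
-- where to stop; the digits of the counter are in the cells to its right.

-- What the machine is doing at the current instruction: about to start it
-- (ready), sweeping a work head to the right (forth), or sweeping it back after
-- changing the counter (back-nz) or after finding that it is 0 (back-z).
Phase : Set
Phase = Fin 4

pattern ready   = 0F
pattern forth   = 1F
pattern back-nz = 2F
pattern back-z  = 3F

-- Rewrite the symbols under the work heads and leave the heads where they are.
keep : Vec Symbol m → Vec (Symbol × Move) m
keep = Vec.map (_, stay)

module Compile {k m : ℕ} (P : Program k m) where

  -- A state is a label together with a phase.
  State′ : Set
  State′ = Fin k × Phase

  Action′ : Set
  Action′ = State′ × Move × Vec (Symbol × Move) m

  -- One step of a work head that returns to cell 0, writing d on the way, to go
  -- on at the label exit from there.
  backStep : State′ → (exit : Fin k) (d h : Symbol) → State′ × Symbol × Move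
  backStep q exit d □ = (exit , ready) , □ , stay
  backStep q exit d 𝟘 = q , d , left
  backStep q exit d 𝟙 = q , d , left

  -- One step of a counting instruction at label ℓ, given the symbol under the
  -- work head: the new state, the symbol written and the move.  An increment
  -- carries over 1s and a decrement borrows over 0s.  When an increment is under
  -- way, phase back-z does not occur.
  countStep : CountOp → (ℓ ℓ₀ ℓ₊ : Fin k) → Phase → Symbol → State′ × Symbol × Move
  countStep op        ℓ ℓ₀ ℓ₊ ready   h = (ℓ , forth) , h , right
  countStep increment ℓ ℓ₀ ℓ₊ forth   □ = (ℓ , back-nz) , 𝟙 , left
  countStep increment ℓ ℓ₀ ℓ₊ forth   𝟘 = (ℓ , back-nz) , 𝟙 , left
  countStep increment ℓ ℓ₀ ℓ₊ forth   𝟙 = (ℓ , forth) , 𝟙 , right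
  countStep increment ℓ ℓ₀ ℓ₊ back-nz h = backStep (ℓ , back-nz) ℓ₊ 𝟘 h
  countStep decrement ℓ ℓ₀ ℓ₊ forth   □ = (ℓ , back-z) , □ , left
  countStep decrement ℓ ℓ₀ ℓ₊ forth   𝟘 = (ℓ , forth) , 𝟘 , right
  countStep decrement ℓ ℓ₀ ℓ₊ forth   𝟙 = (ℓ , back-nz) , 𝟘 , left
  countStep decrement ℓ ℓ₀ ℓ₊ back-nz h = backStep (ℓ , back-nz) ℓ₊ 𝟙 h
  countStep op        ℓ ℓ₀ ℓ₊ back-z  h = backStep (ℓ , back-z) ℓ₀ 𝟘 h

  workAction : Fin m → Vec Symbol m → State′ × Symbol × Move → Action′
  workAction c hs (q , sμ) = q , stay , keep hs [ c ]≔ sμ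

  jump : Fin k → Move → Vec Symbol m → Action′
  jump ℓ μ hs = (ℓ , ready) , μ , keep hs

  actions : Instruction k m → State′ → InputSymbol → Vec Symbol m → List Action′
  actions (read f)           q       s hs = [ jump (proj₂ (f s)) (proj₁ (f s)) hs ]
  actions (count op c ℓ₀ ℓ₊) (ℓ , φ) s hs =
    [ workAction c hs (countStep op ℓ ℓ₀ ℓ₊ φ (Vec.lookup hs c)) ]
  actions (guess ℓ₁ ℓ₂ _)    q       s hs = jump ℓ₁ stay hs ∷ jump ℓ₂ stay hs ∷ []
  actions (halt _)           q       s hs = []

  actions-unique : ∀ I q s hs → Unique (actions I q s hs)
  actions-unique (read _)          q s hs = [] ∷ []
  actions-unique (count _ _ _ _)   q s hs = [] ∷ []
  actions-unique (guess ℓ₁ ℓ₂ ≢)   q s hs = ((λ { refl → ≢ refl }) ∷ []) ∷ [] ∷ []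
  actions-unique (halt _)          q s hs = []

  accepts : Instruction k m → Bool
  accepts (halt b) = b
  accepts _        = false

  machine : (start : Fin k) → NTM
  machine start = record
    { State     = State′
    ; Γ         = Symbol
    ; finState  = k * 4 , ↔-sym Fin.*↔×
    ; finΓ      = 3 , ↔-refl
    ; blank     = □
    ; #tapes    = m
    ; start     = start , ready
    ; accepting = λ (ℓ , _) → accepts (P ℓ)
    ; δ         = λ q s hs → actions (P (proj₁ q)) q s hs
    ; δ-unique  = λ q s hs → actions-unique (P (proj₁ q)) q s hs
    }

-- Simulation

-- The tape of a counter between instructions.
data CounterTape (w : ℕ) : Tape Symbol → ℕ → Set where
  counterTape : ∀ {l v} → Digits w l v → CounterTape w (tape [] □ l) v

-- headAt ls l: the cells to the left of the head are ls, and l lists the cell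
-- under the head and those to its right.  If l is empty, the head is on a new
-- blank cell.
headAt : List Symbol → List Symbol → Tape Symbol
headAt ls []       = tape ls □ []
headAt ls (h ∷ rs) = tape ls h rs

moveTape-right : ∀ ls h rs → moveTape □ right (tape ls h rs) ≡ headAt (h ∷ ls) rs
moveTape-right ls h []      = refl
moveTape-right ls h (_ ∷ _) = refl

-- The cells to the left of a head that has passed j copies of c on its way from
-- cell 0: these copies, and cell 0.
passed : ℕ → Symbol → List Symbol
passed zero    c = □ ∷ []
passed (suc j) c = c ∷ passed j c

length-passed : ∀ j c → length (passed j c) ≡ suc j
length-passed zero    c = refl
length-passed (suc j) c = cong suc (length-passed j c)

-- j copies of d in front of l.
copies : ℕ → Symbol → List Symbol → List Symbol
copies zero    d l = l
copies (suc j) d l = copies j d (d ∷ l)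

Sweep-length : ∀ {Turn c d l l′} → Sweep Turn c d l l′ → length l ≤ length l′
Sweep-length (turn-end _) = z≤n
Sweep-length (turn _)     = ℕ.≤-refl
Sweep-length (pass s)     = s≤s (Sweep-length s)

-- There are at most as many cells when a sweep starts as when it is complete.
Sweep-cells : ∀ {Turn c d l l′} → Sweep Turn c d l l′ →
              ∀ ls → Tape.cells (headAt ls l) ≤ length ls + length l′
Sweep-cells (turn-end _) ls = ℕ.≤-refl
Sweep-cells (turn _)     ls = ℕ.≤-refl
Sweep-cells (pass s)     ls = ℕ.+-monoʳ-≤ (length ls) (s≤s (Sweep-length s))

-- The work tapes ws hold the counter values vs.
Holds : ℕ → Vec (Tape Symbol) m → Vec ℕ m → Set
Holds w = Pointwise (CounterTape w)

Holds-initial : ∀ w m → Holds w (Vec.replicate m (emptyTape □)) (Vec.replicate m 0)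
Holds-initial w zero    = []
Holds-initial w (suc m) = counterTape [] ∷ Holds-initial w m

Holds-update : ∀ {w} {ws : Vec (Tape Symbol) m} {vs t v} → Holds w ws vs → ∀ c →
               CounterTape w t v → Holds w (ws [ c ]≔ t) (vs [ c ]≔ v)
Holds-update (_ ∷ H)  zero    h = h ∷ H
Holds-update (h′ ∷ H) (suc c) h = h′ ∷ Holds-update H c h

Holds-lookup : ∀ {w} {ws : Vec (Tape Symbol) m} {vs} → Holds w ws vs → ∀ c →
               ∃[ l ] ws [ c ]≔ tape [] □ l ≡ ws × Digits w l (Vec.lookup vs c)
Holds-lookup (counterTape D ∷ H) zero    = _ , refl , D
Holds-lookup (h ∷ H)             (suc c) =
  let l , eq , D = Holds-lookup H c in l , cong (_ ∷_) eq , D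

totalCells : Vec (Tape Symbol) m → ℕ
totalCells ws = Vec.sum (Vec.map Tape.cells ws)

CounterTape-cells : ∀ {w t v} → CounterTape w t v → Tape.cells t ≤ 2 + w
CounterTape-cells (counterTape D) = s≤s (Digits-length D)

Holds-cells : ∀ {w} {ws : Vec (Tape Symbol) m} {vs} → Holds w ws vs → totalCells ws ≤ m * (2 + w)
Holds-cells []      = z≤n
Holds-cells (h ∷ H) = ℕ.+-mono-≤ (CounterTape-cells h) (Holds-cells H)

Holds-update-cells : ∀ {w} {ws : Vec (Tape Symbol) m} {vs t} → Holds w ws vs → ∀ c →
                     Tape.cells t ≤ 2 + w → totalCells (ws [ c ]≔ t) ≤ m * (2 + w)
Holds-update-cells (_ ∷ H) zero    le = ℕ.+-mono-≤ le (Holds-cells H)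
Holds-update-cells (h ∷ H) (suc c) le = ℕ.+-mono-≤ (CounterTape-cells h) (Holds-update-cells H c le)

-- The symbols under the work heads.
heads : Vec (Tape Symbol) m → Vec Symbol m
heads = Vec.map Tape.head

heads-at : (ws : Vec (Tape Symbol) m) → ∀ c t → Vec.lookup (heads (ws [ c ]≔ t)) c ≡ Tape.head t
heads-at (_ ∷ ws) zero    t = refl
heads-at (_ ∷ ws) (suc c) t = heads-at ws c t

perform-keep : (ws : Vec (Tape Symbol) m) → Vec.zipWith (writeMove □) (keep (heads ws)) ws ≡ ws
perform-keep []       = refl
perform-keep (t ∷ ws) = cong (t ∷_) (perform-keep ws)

perform-at : (ws : Vec (Tape Symbol) m) → ∀ c t sμ →
             Vec.zipWith (writeMove □) (keep (heads (ws [ c ]≔ t)) [ c ]≔ sμ) (ws [ c ]≔ t)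
             ≡ ws [ c ]≔ writeMove □ sμ t
perform-at (_ ∷ ws)  zero    t sμ = cong (_ ∷_) (perform-keep ws)
perform-at (t′ ∷ ws) (suc c) t sμ = cong (t′ ∷_) (perform-at ws c t sμ)

-- The machine of P on input x, the counters being at most bound < 2 ^ w.
module Simulate {k m : ℕ} (P : Program k m) (x : String) (start : Fin k)
                (w bound : ℕ) (bound<2^w : bound < 2 ^ w) where
  open Compile P
  open NTM (machine start) using (Config; config)
  open NTM.Run (machine start) x using (enabled; perform)
  open Computation (machine start) x

  maxCells : ℕ
  maxCells = m * (2 + w)

  -- An action that keeps the work tapes does nothing to them.
  keeping : ∀ {ℓ ws} → ComputationTree maxCells (config (ℓ , ready) i ws) n →
            ComputationTree maxCells
              (config (ℓ , ready) i (Vec.zipWith (writeMove □) (keep (heads ws)) ws)) n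
  keeping {ws = ws} =
    subst (λ ws′ → ComputationTree maxCells (config _ _ ws′) _) (sym (perform-keep ws))

  -- A counting instruction at label ℓ on counter c, with the input head on cell
  -- i.  The tapes of the other counters are those in ws.
  module Counting {ℓ : Fin k} {op : CountOp} {c : Fin m} {ℓ₀ ℓ₊ : Fin k}
                  (P≡ : P ℓ ≡ count op c ℓ₀ ℓ₊) (i : ℕ)
                  {ws : Vec (Tape Symbol) m} {vs : Vec ℕ m} (H : Holds w ws vs) {n : ℕ} where

    -- The computation from state q with t as the tape of counter c.
    From : State′ → Tape Symbol → Set
    From q t = ComputationTree maxCells (config q i (ws [ c ]≔ t)) n

    workStep : ∀ {φ q sμ} t → Tape.cells t ≤ 2 + w →
               countStep op ℓ ℓ₀ ℓ₊ φ (Tape.head t) ≡ (q , sμ) →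
               From q (writeMove □ sμ t) → From (ℓ , φ) t
    workStep {φ} {q} {sμ} t le eq tree = unary enabled≡ (Holds-update-cells H c le)
      (subst (λ ws′ → ComputationTree maxCells (config q i ws′) n) (sym (perform-at ws c t sμ)) tree)
      where
      open ≡-Reasoning
      hs : Vec Symbol m
      hs = heads (ws [ c ]≔ t)

      enabled≡ : enabled (config (ℓ , φ) i (ws [ c ]≔ t)) ≡ [ workAction c hs (q , sμ) ]
      enabled≡ = begin
        actions (P ℓ) (ℓ , φ) (readInput x i) hs
          ≡⟨ cong (λ I → actions I (ℓ , φ) (readInput x i) hs) P≡ ⟩
        [ workAction c hs (countStep op ℓ ℓ₀ ℓ₊ φ (Vec.lookup hs c)) ]
          ≡⟨ cong (λ h → [ workAction c hs (countStep op ℓ ℓ₀ ℓ₊ φ h) ]) (heads-at ws c t) ⟩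
        [ workAction c hs (countStep op ℓ ℓ₀ ℓ₊ φ (Tape.head t)) ]
          ≡⟨ cong (λ a → [ workAction c hs a ]) eq ⟩
        [ workAction c hs (q , sμ) ] ∎

    -- At the start, the tape of counter c holds its digits.
    load : ∀ {q} → (∀ {l} → Digits w l (Vec.lookup vs c) → From q (tape [] □ l)) →
           ComputationTree maxCells (config q i ws) n
    load {q} tree = let l , eq , D = Holds-lookup H c in
      subst (λ ws′ → ComputationTree maxCells (config q i ws′) n) eq (tree D)

    -- A sweep as performed by the machine: in phase forth it passes over copies
    -- of c′ and turns, and in phase φ it comes back, replacing c′ by d.
    module Sweeping {Turn : Symbol → Symbol → Set} {c′ d : Symbol} {φ : Phase} {exit : Fin k}
      (forth-c  : countStep op ℓ ℓ₀ ℓ₊ forth c′ ≡ ((ℓ , forth) , c′ , right))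
      (forth-turn : ∀ {h g : Symbol} → Turn h g → countStep op ℓ ℓ₀ ℓ₊ forth h ≡ ((ℓ , φ) , g , left))
      (back-c   : countStep op ℓ ℓ₀ ℓ₊ φ c′ ≡ ((ℓ , φ) , d , left))
      (back-□   : countStep op ℓ ℓ₀ ℓ₊ φ □ ≡ ((exit , ready) , □ , stay)) where

      back : ∀ j g l → suc j + suc (length l) ≤ 2 + w →
             From (exit , ready) (tape [] □ (copies j d (g ∷ l))) →
             From (ℓ , φ) (moveTape □ left (tape (passed j c′) g l))
      back zero    g l le tree = workStep (tape [] □ (g ∷ l)) le back-□ tree
      back (suc j) g l le tree = workStep (tape (passed j c′) c′ (g ∷ l))
        (subst (_≤ 2 + w) (sym (trans (cong (_+ _) (length-passed j c′)) (ℕ.+-suc (suc j) _))) le)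
        back-c (back j d (g ∷ l) (subst (_≤ 2 + w) (sym (ℕ.+-suc (suc j) _)) le) tree)

      sweep : ∀ j {l l′} → Sweep Turn c′ d l l′ → suc j + length l′ ≤ 2 + w →
              From (exit , ready) (tape [] □ (copies j d l′)) →
              From (ℓ , forth) (headAt (passed j c′) l)
      sweep j {l} {l′} s le tree = go s tree
        where
        fits : Tape.cells (headAt (passed j c′) l) ≤ 2 + w
        fits = ℕ.≤-trans (Sweep-cells s (passed j c′))
                         (subst (λ z → z + length l′ ≤ 2 + w) (sym (length-passed j c′)) le)

        go : Sweep Turn c′ d l l′ → From (exit , ready) (tape [] □ (copies j d l′)) →
             From (ℓ , forth) (headAt (passed j c′) l)
        go (turn-end {g} t) tree = workStep _ fits (forth-turn t) (back j g [] le tree)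
        go (turn {g = g} {l = r} t) tree = workStep _ fits (forth-turn t) (back j g r le tree)
        go (pass {l = r} {l′ = r′} s′) tree = workStep _ fits forth-c
          (subst (From (ℓ , forth)) (sym (moveTape-right (passed j c′) c′ r))
            (sweep (suc j) s′ (subst (_≤ 2 + w) (ℕ.+-suc (suc j) (length r′)) le) tree))

      sweep-counter : ∀ {l l′ v v′} → Sweep Turn c′ d l l′ → Digits w l v → Digits w l′ v′ →
                      From (exit , ready) (tape [] □ l′) → From (ℓ , ready) (tape [] □ l)
      sweep-counter {l} s D D′ tree = workStep _ (s≤s (Digits-length D)) refl
        (subst (From (ℓ , forth)) (sym (moveTape-right [] □ l))
          (sweep 0 s (s≤s (Digits-length D′)) tree))

  open Counting
  open Sweeping

  -- The machine does what the program does, one instruction after the other.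
  simulate : ∀ {ℓ i v n ws} → Run P x bound ℓ i v n → Holds w ws v →
             ComputationTree maxCells (config (ℓ , ready) i ws) n
  simulate {ℓ} {i} {ws = ws} (halt {b} P≡) H =
    subst (λ b′ → ComputationTree maxCells (config (ℓ , ready) i ws) (if b′ then 1 else 0))
          (cong accepts P≡)
          (leaf (cong (λ I → actions I (ℓ , ready) (readInput x i) (heads ws)) P≡) (Holds-cells H))
  simulate {ℓ} {i} {ws = ws} (read {μ = μ} {ℓ′} P≡ s≡ f≡ run) H =
    unary (trans (cong (λ I → actions I (ℓ , ready) (readInput x i) (heads ws)) P≡)
                 (cong (λ (μ , ℓ) → [ jump ℓ μ (heads ws) ]) (trans (cong _ s≡) f≡)))
          (Holds-cells H) (keeping (simulate run H))
  simulate {ℓ} {i} {ws = ws} (guess P≡ run₁ run₂) H =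
    binary (cong (λ I → actions I (ℓ , ready) (readInput x i) (heads ws)) P≡) (Holds-cells H)
           (keeping (simulate run₁ H)) (keeping (simulate run₂ H))
  simulate {i = i} {v} (inc {c} P≡ v< run) H = load P≡ i H λ D →
    let l′ , s , D′ = Digits-suc D (ℕ.≤-<-trans v< bound<2^w)
    in sweep-counter P≡ i H refl (λ { □↦𝟙 → refl ; 𝟘↦𝟙 → refl }) refl refl s D D′
         (simulate run (Holds-update H c (counterTape D′)))
  simulate {i = i} {v} (dec₀ {c} P≡ v≡0 run) H = load P≡ i H λ D →
    let l′ , s , D′ = Digits-zero (subst (Digits w _) v≡0 D)
    in sweep-counter P≡ i H refl (λ { □↦□ → refl }) refl refl s D D′
         (simulate run (subst (Holds w _) (unchanged v≡0) (Holds-update H c (counterTape D′))))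
    where
    unchanged : ∀ {u} → Vec.lookup v c ≡ u → v [ c ]≔ u ≡ v
    unchanged refl = Vec.[]≔-lookup v c
  simulate {i = i} {v} (dec₊ {c} P≡ v≡ run) H = load P≡ i H λ D →
    let l′ , s , D′ = Digits-pred (subst (Digits w _) v≡ D)
    in sweep-counter P≡ i H refl (λ { 𝟙↦𝟘 → refl }) refl refl s D D′
         (simulate run (Holds-update H c (counterTape D′)))

  simulate-initial : ∀ {n} → Run P x bound start 0 (Vec.replicate m 0) n →
                     ComputationTree maxCells (NTM.initial (machine start)) n
  simulate-initial run = simulate run (Holds-initial w m)

-- The counter program

-- The labels are the elements of Fin 25; each pattern is the successor of the
-- one before it.
pattern main      = zero
pattern main0     = suc main
pattern main1     = suc main0
pattern finish    = suc main1
pattern countˡ    = suc finish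
pattern scanL     = suc countˡ
pattern scanL0    = suc scanL
pattern scanL0+   = suc scanL0
pattern scanL1    = suc scanL0+
pattern scanL1+   = suc scanL1
pattern next      = suc scanL1+
pattern scanR     = suc next
pattern scanR0    = suc scanR
pattern scanR1    = suc scanR0
pattern scanR1+   = suc scanR1
pattern scanR⊣    = suc scanR1+
pattern last      = suc scanR⊣
pattern deal      = suc last
pattern dealˡ     = suc deal
pattern dealʳ     = suc dealˡ
pattern dealt     = suc dealʳ
pattern return    = suc dealt
pattern return+   = suc return
pattern yes!      = suc return+
pattern no!       = suc yes!

-- The counters: the number e of open edges around the current position; and, for
-- the 1 being processed, the counts a and b and the depth d of the scans, and the
-- distance r of the input head from the cell after this 1.
pattern #a = 0F
pattern #b = 1F
pattern #d = 2F
pattern #e = 3F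
pattern #r = 4F

add1 : Fin 5 → Fin 25 → Instruction 25 5
add1 c ℓ = count increment c ℓ ℓ

sub1 : Fin 5 → (ℓ₀ ℓ₊ : Fin 25) → Instruction 25 5
sub1 = count decrement

-- At main, the head is on the next symbol to be processed and all counters but
-- e are 0.  A 1 is processed by the scans of the two parts (scanL, scanR), the
-- guessing of a shuffle, which takes a and b down to 0 (deal), and the return of
-- the head to the cell after the 1 (return).  A scan reads a symbol and leaves it
-- in one step, and increments r afterwards.
program : Program 25 5
program main = read λ
  { ⊢ → right , main ; (bit 0F) → right , main0 ; (bit 1F) → right , main1 ; ⊣ → stay , finish }
program main0   = sub1 #e no! main
program main1   = add1 #e countˡ
-- At the end of the input, no edge may be open.
program finish  = sub1 #e yes! no!
program countˡ  = add1 #a scanL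
program scanL = read λ
  { (bit 0F) → right , scanL0 ; (bit 1F) → right , scanL1 ; _ → stay , no! }
program scanL0  = sub1 #d next scanL0+
program scanL0+ = add1 #r scanL
program scanL1  = add1 #d scanL1+
program scanL1+ = add1 #r countˡ
program next    = add1 #r scanR
program scanR = read λ
  { (bit 0F) → right , scanR0 ; (bit 1F) → right , scanR1 ; _ → stay , scanR⊣ }
program scanR0  = sub1 #d last next
program scanR1  = add1 #d scanR1+
program scanR1+ = add1 #b next
-- The head stays on the end marker, so r is not incremented.
program scanR⊣  = sub1 #d deal no!
program last    = add1 #r deal
program deal    = guess dealˡ dealʳ λ ()
-- Taking a left or a right item fails if there is none, except that finding b = 0
-- when a = 0 as well is how the guessing ends.  This way exactly one of the two
-- guesses leads on from a = b = 0.
program dealˡ   = sub1 #a no! deal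
program dealʳ   = sub1 #b dealt deal
program dealt   = sub1 #a return no!
program return  = sub1 #r main return+
program return+ = read λ _ → left , return
program yes!    = halt true
program no!     = halt false

-- The computation of the program

-- Suffix x i s: what remains of x after its first i symbols is s.  The first
-- symbol of s is then on cell i + 1 of the input tape.
data Suffix : String → ℕ → String → Set where
  whole : ∀ {s} → Suffix s 0 s
  skip  : ∀ {b x i s} → Suffix x i s → Suffix (b ∷ x) (suc i) s

Suffix-tail : ∀ {x i b s} → Suffix x i (b ∷ s) → Suffix x (suc i) s
Suffix-tail whole     = skip whole
Suffix-tail (skip sf) = skip (Suffix-tail sf)

Suffix-< : ∀ {x i b s} → Suffix x i (b ∷ s) → i < length x
Suffix-< whole     = s≤s z≤n
Suffix-< (skip sf) = s≤s (Suffix-< sf)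

readInput-bit : ∀ {x i b s} → Suffix x i (b ∷ s) → readInput x (suc i) ≡ bit b
readInput-bit whole     = refl
readInput-bit (skip sf) = readInput-bit sf

readInput-⊣ : ∀ {x i} → Suffix x i [] → readInput x (suc i) ≡ ⊣
readInput-⊣ whole     = refl
readInput-⊣ (skip sf) = readInput-⊣ sf

moveInput-right : ∀ {x i b s} → Suffix x i (b ∷ s) → moveInput x right (suc i) ≡ suc (suc i)
moveInput-right sf = cong suc (ℕ.m≤n⇒m⊓n≡m (Suffix-< sf))

module _ (x : String) where
  private
    Runs : Fin 25 → ℕ → Vec ℕ 5 → ℕ → Set
    Runs = Run program x (length x)

    variable
      s : String
      v : Vec ℕ 5

  rejected : Runs no! i v 0
  rejected = halt refl

  -- Reading a symbol of the input and moving to the next cell.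
  read-bit : ∀ {ℓ f β ℓ′} → program ℓ ≡ read f → Suffix x i (β ∷ s) → f (bit β) ≡ (right , ℓ′) →
             Runs ℓ′ (suc (suc i)) v n → Runs ℓ (suc i) v n
  read-bit {v = v} {n = n} {ℓ′ = ℓ′} P≡ sf f≡ run =
    read P≡ (readInput-bit sf) f≡ (subst (λ j → Runs ℓ′ j v n) (sym (moveInput-right sf)) run)

  -- Cell p + 1 is the one after the 1 being processed, and n is the number of
  -- accepting paths from the next visit of main; likewise for the scans below.
  returning : ∀ r → Runs main (suc p) (0 ∷ 0 ∷ 0 ∷ e ∷ 0 ∷ []) n →
              Runs return (suc (r + p)) (0 ∷ 0 ∷ 0 ∷ e ∷ r ∷ []) n
  returning zero    run = dec₀ refl refl run
  returning (suc r) run = dec₊ refl refl (read refl refl refl (returning r run))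

  -- Each of the shuffles of a and b items is guessed on exactly one path.
  dealing : ∀ a b → Runs return i (0 ∷ 0 ∷ d ∷ e ∷ r ∷ []) n →
            Runs deal i (a ∷ b ∷ d ∷ e ∷ r ∷ []) (shuffles a b * n)
  dealing {n = n} zero zero run = subst (Runs _ _ _) (sym (ℕ.*-identityˡ n))
    (guess refl (dec₀ refl refl rejected) (dec₀ refl refl (dec₀ refl refl run)))
  dealing zero (suc b) run =
    guess refl (dec₀ refl refl rejected) (dec₊ refl refl (dealing zero b run))
  dealing (suc a) zero run = subst (Runs _ _ _) (ℕ.+-identityʳ _)
    (guess refl (dec₊ refl refl (dealing a zero run)) (dec₀ refl refl (dec₊ refl refl rejected)))
  dealing {n = n} (suc a) (suc b) run =
    subst (Runs _ _ _) (sym (ℕ.*-distribʳ-+ n (shuffles a (suc b)) (shuffles (suc a) b)))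
      (guess refl (dec₊ refl refl (dealing a (suc b) run)) (dec₊ refl refl (dealing (suc a) b run)))

  -- The counters b and d, and likewise a, never exceed the number r + p of symbols
  -- before the head, so they stay within the length of the input.
  scanningR : ∀ s a b d r → Suffix x (r + p) s → b ≤ r + p → d ≤ r + p →
              Runs main (suc p) (0 ∷ 0 ∷ 0 ∷ e ∷ 0 ∷ []) n →
              Runs scanR (suc (r + p)) (a ∷ b ∷ d ∷ e ∷ r ∷ []) (scanʳ s a b d * n)
  scanningR [] a b zero r sf b≤ d≤ run =
    read refl (readInput-⊣ sf) refl (dec₀ refl refl (dealing a b (returning r run)))
  scanningR [] a b (suc d) r sf b≤ d≤ run =
    read refl (readInput-⊣ sf) refl (dec₊ refl refl rejected)
  scanningR (1F ∷ s) a b d r sf b≤ d≤ run = read-bit refl sf refl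
    (inc refl (ℕ.≤-<-trans d≤ (Suffix-< sf))
    (inc refl (ℕ.≤-<-trans b≤ (Suffix-< sf))
    (inc refl (ℕ.≤-<-trans (ℕ.m≤m+n r _) (Suffix-< sf))
    (scanningR s a (suc b) (suc d) (suc r) (Suffix-tail sf) (s≤s b≤) (s≤s d≤) run))))
  scanningR (0F ∷ s) a b zero r sf b≤ d≤ run = read-bit refl sf refl
    (dec₀ refl refl
    (inc refl (ℕ.≤-<-trans (ℕ.m≤m+n r _) (Suffix-< sf))
    (dealing a b (returning (suc r) run))))
  scanningR (0F ∷ s) a b (suc d) r sf b≤ d≤ run = read-bit refl sf refl
    (dec₊ refl refl
    (inc refl (ℕ.≤-<-trans (ℕ.m≤m+n r _) (Suffix-< sf))
    (scanningR s a b d (suc r) (Suffix-tail sf) (ℕ.m≤n⇒m≤1+n b≤) (ℕ.m≤n⇒m≤1+n (ℕ.<⇒≤ d≤)) run)))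

  scanningL : ∀ s a d r → Suffix x (r + p) s → a ≤ r + p → d ≤ r + p →
              Runs main (suc p) (0 ∷ 0 ∷ 0 ∷ e ∷ 0 ∷ []) n →
              Runs scanL (suc (r + p)) (a ∷ 0 ∷ d ∷ e ∷ r ∷ []) (scanˡ s a d * n)
  scanningL [] a d r sf a≤ d≤ run = read refl (readInput-⊣ sf) refl rejected
  scanningL (1F ∷ s) a d r sf a≤ d≤ run = read-bit refl sf refl
    (inc refl (ℕ.≤-<-trans d≤ (Suffix-< sf))
    (inc refl (ℕ.≤-<-trans (ℕ.m≤m+n r _) (Suffix-< sf))
    (inc refl (ℕ.≤-<-trans a≤ (Suffix-< sf))
    (scanningL s (suc a) (suc d) (suc r) (Suffix-tail sf) (s≤s a≤) (s≤s d≤) run))))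
  scanningL (0F ∷ s) a zero r sf a≤ d≤ run = read-bit refl sf refl
    (dec₀ refl refl
    (inc refl (ℕ.≤-<-trans (ℕ.m≤m+n r _) (Suffix-< sf))
    (scanningR s a 0 0 (suc r) (Suffix-tail sf) z≤n z≤n run)))
  scanningL (0F ∷ s) a (suc d) r sf a≤ d≤ run = read-bit refl sf refl
    (dec₊ refl refl
    (inc refl (ℕ.≤-<-trans (ℕ.m≤m+n r _) (Suffix-< sf))
    (scanningL s a d (suc r) (Suffix-tail sf) (ℕ.m≤n⇒m≤1+n a≤) (ℕ.m≤n⇒m≤1+n (ℕ.<⇒≤ d≤)) run)))

  running : ∀ s i e → Suffix x i s → e ≤ i →
            Runs main (suc i) (0 ∷ 0 ∷ 0 ∷ e ∷ 0 ∷ []) (total s e)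
  running [] i zero sf e≤ = read refl (readInput-⊣ sf) refl (dec₀ refl refl (halt refl))
  running [] i (suc e) sf e≤ = read refl (readInput-⊣ sf) refl (dec₊ refl refl rejected)
  running (0F ∷ s) i zero sf e≤ = read-bit refl sf refl (dec₀ refl refl rejected)
  running (0F ∷ s) i (suc e) sf e≤ = read-bit refl sf refl
    (dec₊ refl refl (running s (suc i) e (Suffix-tail sf) (ℕ.m≤n⇒m≤1+n (ℕ.<⇒≤ e≤))))
  running (1F ∷ s) i e sf e≤ = read-bit refl sf refl
    (inc refl (ℕ.≤-<-trans e≤ (Suffix-< sf))
    (inc refl (ℕ.≤-<-trans z≤n (Suffix-< sf))
    (scanningL s 1 0 0 (Suffix-tail sf) (s≤s z≤n) z≤n
      (running s (suc i) (suc e) (Suffix-tail sf) (s≤s e≤)))))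

  run-program : Runs main 0 (Vec.replicate 5 0) (countExtensions x)
  run-program = read refl refl refl (running x 0 0 whole z≤n)

-- Logarithmic space

n<2^[1+log₂n] : ∀ n → n < 2 ^ suc ⌊log₂ n ⌋
n<2^[1+log₂n] n = ℕ.≰⇒> λ 2^≤n → ℕ.<-irrefl refl
  (subst (_≤ ⌊log₂ n ⌋) (⌊log₂[2^n]⌋≡n (suc ⌊log₂ n ⌋)) (⌊log₂⌋-mono-≤ 2^≤n))

-- The counters are bounded by the length of the input, so 1 + ⌊log₂ |x|⌋ digits
-- suffice, and each of the five tapes has at most two cells more.  From length 2
-- on, the logarithm is at least 1 and absorbs the constants.
countExtensions-#L : countExtensions ∈#L
countExtensions-#L = tree-#L (Compile.machine program main) countExtensions 20 2
  (λ x → 5 * (2 + suc ⌊log₂ length x ⌋))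
  (λ x → Simulate.simulate-initial program x main (suc ⌊log₂ length x ⌋) (length x)
           (n<2^[1+log₂n] (length x)) (run-program x))
  λ x 2≤ → logarithmic (⌊log₂⌋-mono-≤ 2≤)
  where
  open ℕ.≤-Reasoning
  logarithmic : ∀ {l} → 1 ≤ l → 5 * (3 + l) ≤ 20 * l
  logarithmic {l} 1≤l = begin
    5 * (3 + l)      ≡⟨ cong (5 *_) (ℕ.+-comm 3 l) ⟩
    5 * (l + 3)      ≤⟨ ℕ.*-monoʳ-≤ 5 (ℕ.+-monoʳ-≤ l (ℕ.*-monoʳ-≤ 3 1≤l)) ⟩
    5 * (4 * l)      ≡⟨ ℕ.*-assoc 5 4 l ⟨
    20 * l           ∎

theorem3p18 : ∃[ e ] (∀ t → HasCardinality (LinearExtensions t) (e t)) ×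
    (∃[ f ] ZeroExtension dfs e f × f ∈#L)
theorem3p18 = #ext , LinearExtensions-cardinality ,
  countExtensions , (countExtensions-dfs , countExtensions-zero) , countExtensions-#L
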